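{- Let $k$ be a positive integer. Every $k$-connected graph $G$ with $\delta(G)\ge k+1$ contains a $k$-removable matching of size $\left\lceil(\delta(G)+1)/2\right\rceil$, unless either $k=1$ and $G$ is a cycle, or $\delta(G)$ is even and $G\cong K_{\delta(G)+1}$.
   Context: All graphs are finite, undirected and simple. $\delta(G)$ is the minimum degree of $G$. A graph is $k$-connected in the usual sense: it has more than $k$ vertices and deleting any set of fewer than $k$ vertices leaves a connected graph. For a $k$-connected graph $G$, a matching $M\subseteq E(G)$ (a set of pairwise vertex-disjoint edges) is called $k$-removable if the graph $G-M$, obtained from $G$ by deleting the edges in $M$ (keeping all vertices), is $k$-connected. The size of a matching is its number of edges. -}

module Defs where

open import Level using (0ℓ)
open import Data.Nat using (ℕ; zero; suc; _+_; _<_; _⊓_)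
import Data.Nat.Properties as ℕ
open import Data.Fin using (Fin; toℕ)
import Data.Fin.Properties as Fin
open import Data.Fin.Subset using (Subset; _∈_; ∁; ∣_∣)
open import Data.Vec using (tabulate; foldr₁)
open import Data.List using (List; length)
open import Data.List.Relation.Unary.Any using (Any; any?)
import Data.List.Relation.Unary.Any as Any
open import Data.List.Relation.Unary.AllPairs using (AllPairs)
open import Data.Product using (Σ; ∃; ∃₂; _×_; _,_; proj₁)
open import Data.Sum using (_⊎_; inj₁; inj₂; swap)
open import Function.Bundles using (_↔_; _⇔_; Inverse)
open import Relation.Nullary using (¬_; does; ¬?; _×-dec_; _⊎-dec_)
open import Relation.Binary using (Rel; Symmetric; Irreflexive; Decidable)
open import Relation.Binary.Construct.Closure.ReflexiveTransitive using (Star)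
open import Relation.Binary.PropositionalEquality using (_≡_; _≢_; refl; sym)

record Graph (V : Set) : Set₁ where
  infix 4 _~_ _~?_
  field
    _~_      : Rel V 0ℓ
    ~-sym    : Symmetric _~_
    ~-irrefl : Irreflexive _≡_ _~_
    _~?_     : Decidable _~_

infix 4 _≅_
_≅_ : {V W : Set} → Graph V → Graph W → Set
_≅_ {V} {W} G H =
  Σ (V ↔ W) λ f → ∀ u v → (u G.~ v) ⇔ (Inverse.to f u H.~ Inverse.to f v)
  where
  module G = Graph G
  module H = Graph H

complete : (n : ℕ) → Graph (Fin n)
complete n = record
  { _~_      = _≢_
  ; ~-sym    = λ u≢v v≡u → u≢v (sym v≡u)
  ; ~-irrefl = λ u≡v u≢v → u≢v u≡v
  ; _~?_     = λ u v → ¬? (u Fin.≟ v)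
  }

-- j is the cyclic successor of i, i.e. j = i + 1 modulo n.
Next : {n : ℕ} → Rel (Fin n) 0ℓ
Next {n} i j = (suc (toℕ i) ≡ toℕ j) ⊎ (suc (toℕ i) ≡ n × toℕ j ≡ 0)

next? : {n : ℕ} → Decidable (Next {n})
next? {n} i j =
  (suc (toℕ i) ℕ.≟ toℕ j) ⊎-dec ((suc (toℕ i) ℕ.≟ n) ×-dec (toℕ j ℕ.≟ 0))

¬next-refl : {m : ℕ} (i : Fin (3 + m)) → ¬ Next i i
¬next-refl i (inj₁ eq)         = ℕ.1+n≢n eq
¬next-refl i (inj₂ (eq , i≡0)) rewrite i≡0 with eq
... | ()

cycle : (m : ℕ) → Graph (Fin (3 + m))
cycle m = record
  { _~_      = λ i j → Next i j ⊎ Next j i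
  ; ~-sym    = swap
  ; ~-irrefl = λ { {i} refl (inj₁ p) → ¬next-refl i p
                 ; {i} refl (inj₂ p) → ¬next-refl i p }
  ; _~?_     = λ i j → next? i j ⊎-dec next? j i
  }

IsCycle : {V : Set} → Graph V → Set
IsCycle G = ∃ λ m → G ≅ cycle m

module _ {n : ℕ} (G : Graph (Fin n)) where
  open Graph G

  neighbours : Fin n → Subset n
  neighbours u = tabulate λ v → does (u ~? v)

  degree : Fin n → ℕ
  degree u = ∣ neighbours u ∣

-- The value on the graph without vertices is a junk value.
δ : {n : ℕ} → Graph (Fin n) → ℕ
δ {zero}  G = 0
δ {suc n} G = foldr₁ _⊓_ (tabulate (degree G))

Connected : {V : Set} → Graph V → Set
Connected G = ∀ u v → Star (Graph._~_ G) u v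

-- Membership in the complement ∁ S, unlike the negation v ∉ S, is
-- proof-irrelevant, so the new vertex type has one element per vertex outside S.
deleteVertices : {n : ℕ} → Graph (Fin n) → (S : Subset n) → Graph (∃ λ v → v ∈ ∁ S)
deleteVertices G S = record
  { _~_      = λ u v → proj₁ u ~ proj₁ v
  ; ~-sym    = ~-sym
  ; ~-irrefl = λ { refl → ~-irrefl refl }
  ; _~?_     = λ u v → proj₁ u ~? proj₁ v
  }
  where open Graph G

KConnected : {n : ℕ} → ℕ → Graph (Fin n) → Set
KConnected {n} k G =
  k < n × ((S : Subset n) → ∣ S ∣ < k → Connected (deleteVertices G S))

-- An edge carries an arbitrary orientation, which Joins forgets.
Edge : {V : Set} → Graph V → Set
Edge G = ∃₂ λ u v → Graph._~_ G u v

Joins : {V : Set} {G : Graph V} → Edge G → V → V → Set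
Joins (x , y , _) u v = (x ≡ u × y ≡ v) ⊎ (x ≡ v × y ≡ u)

VertexDisjoint : {V : Set} {G : Graph V} → Rel (Edge G) 0ℓ
VertexDisjoint (u , v , _) (x , y , _) = u ≢ x × u ≢ y × v ≢ x × v ≢ y

-- Vertex-disjointness at distinct positions rules out repetitions (in either
-- orientation), so the length of the list is the number of edges.
record Matching {V : Set} (G : Graph V) : Set where
  field
    edges    : List (Edge G)
    disjoint : AllPairs (VertexDisjoint {G = G}) edges

  size : ℕ
  size = length edges

deleteEdges : {n : ℕ} (G : Graph (Fin n)) → List (Edge G) → Graph (Fin n)
deleteEdges {n} G es = record
  { _~_      = λ u v → u ~ v × ¬ Deleted u v
  ; ~-sym    = λ { (u~v , ¬d) → ~-sym u~v , λ d → ¬d (Any.map swap d) }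
  ; ~-irrefl = λ u≡v p → ~-irrefl u≡v (proj₁ p)
  ; _~?_     = λ u v → (u ~? v) ×-dec ¬? (any? (λ e → joins? e u v) es)
  }
  where
  open Graph G

  Deleted : Rel (Fin n) 0ℓ
  Deleted u v = Any (λ e → Joins {G = G} e u v) es

  joins? : (e : Edge G) → Decidable (Joins {G = G} e)
  joins? (x , y , _) u v =
    ((x Fin.≟ u) ×-dec (y Fin.≟ v)) ⊎-dec ((x Fin.≟ v) ×-dec (y Fin.≟ u))

Removable : {n : ℕ} → ℕ → (G : Graph (Fin n)) → Matching G → Set
Removable k G M = KConnected k (deleteEdges G (Matching.edges M))

{-# OPTIONS --safe #-}

-- While a k-removable matching M has at most δ/2 edges it can be enlarged by one edge. Put
-- H = G − M, let W be the set of the vertices covered by M, so |W| ≤ δ, and U the rest.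
--
-- An edge xy of H[U] can be added to M unless H − xy has a separation with fewer than k
-- vertices outside its sides A ∋ x and B ∋ y. Submodularity shows that B shrinks when one
-- moves on from xy to a further edge yz, so if no edge can be added, H[U] is a forest.
-- Counting the neighbours of its leaves, which need δ ≥ k + 1 of them, then forces
-- δ = |W| = k + 1, H[U] to be a path l … e, and W = Z ∪ {ν, μ}, where every vertex of Z is
-- adjacent to all vertices outside Z and H − Z is the path μ l … e ν. As ν has only k
-- neighbours in H, νμ is an edge of M. If H[U] has no edge, all edges between U and Z = W
-- are present.
--
-- In both cases an edge xy of M inside Z and distinct vertices u, v of U allow M to be
-- enlarged by replacing xy with ux and vy. The required edge or vertices are missing only
-- if k = 1, Z is empty and G is the cycle ν μ l … e, or if |U| ≤ 1, δ is even and G is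
-- complete.

module Submission where

open import Data.Nat using (ℕ; zero; suc; _+_; _*_; _≤_; _<_; z≤n; s≤s; _≤ᵇ_; _⊓_; ⌈_/2⌉)
open import Data.Nat.Properties as ℕ using (≤-refl; ≤-trans; ≤-reflexive; module ≤-Reasoning)
open import Data.Nat.Divisibility using (_∣_; divides)
open import Algebra.Properties.CommutativeSemigroup ℕ.+-commutativeSemigroup using (interchange)
open import Data.Bool using (Bool; true; false; T; _∧_)
open import Data.Bool.Properties using (T-∧)
open import Data.Fin using (Fin; zero; suc; toℕ; fromℕ<)
import Data.Fin.Properties as Fin
open import Data.Fin.Subset as Subset using (Subset; _∈_; _∉_; Nonempty; Empty)
open import Data.Fin.Subset.Properties as Subset using (_∈?_; nonempty?; anySubset?)
open import Data.Vec as Vec using (Vec; []; _∷_; tabulate; foldr₁)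
open import Data.Vec.Properties using (lookup∘tabulate; []=⇒lookup; lookup⇒[]=)
open import Data.List as List using (List; []; _∷_; length)
open import Data.List.Relation.Unary.Any as Any using (Any; here; there; any?)
open import Data.List.Relation.Unary.All as All using (All; []; _∷_)
open import Data.List.Relation.Unary.All.Properties using (¬Any⇒All¬)
open import Data.List.Relation.Unary.AllPairs as AllPairs using (AllPairs; []; _∷_)
open import Data.List.Relation.Binary.Permutation.Propositional as Perm using (_↭_; ↭-sym)
open import Data.List.Relation.Binary.Permutation.Propositional.Properties using (Any-resp-↭; All-resp-↭; ↭-length)
open import Data.Product using (∃; ∃₂; _×_; _,_; proj₁; proj₂)
open import Data.Sum as Sum using (_⊎_; inj₁; inj₂; [_,_]′)
open import Function using (_∘_; case_of_)
open import Function.Bundles using (Equivalence; mk⇔; mk↔ₛ′)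
open import Relation.Nullary using (¬_; Dec; yes; no; does; contradiction; ¬?; _×-dec_; _⊎-dec_; _→-dec_)
open import Relation.Nullary.Decidable using (decidable-stable; dec-true; map′)
open import Relation.Unary using (Decidable)
open import Relation.Binary using (Symmetric; tri<; tri≈; tri>)
open import Relation.Binary.Construct.Closure.ReflexiveTransitive using (Star; ε; _◅_; _◅◅_)
open import Relation.Binary.PropositionalEquality
  using (_≡_; _≢_; refl; sym; trans; cong; cong₂; subst; module ≡-Reasoning)
open import Defs

-- Deleting a matching costs a vertex at most one neighbour, so degrees in `H` stay at least `k`,
-- while uncovered vertices keep at least `δ ≥ k + 1` neighbours. The decisive count takes a leaf
-- `g` of `H[U]`, its neighbour `p`, and a separation with sides `L ∋ g` and `P ∋ p`. As `gp` is the
-- only edge between the sides, at least `δ - 1` neighbours of `g` lie in `W` outside `P`, so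
-- `|W| ≤ δ` leaves at most one vertex of `W` in `P`. A suitable vertex at an end of the forest
-- inside `P` sees at most `k - 1` vertices outside both sides, one of `W`, and one more; hence
-- `δ ≤ k + 1`. Tightness of such counts is then read as adjacency. In particular a leaf misses
-- exactly one vertex of `W`; different leaves miss different vertices, and only two candidates
-- exist, so there are exactly two leaves. The exchange is safe because `Z` is joined to everything
-- else: a separation with too few vertices outside its sides would have to lie across `ux` or `vy`,
-- and then either a second missing edge at the same vertex or the restored edge `xy` gives a
-- contradiction.

absurd : ∀ {a} {A : Set a} → 1 ≤ 0 → A
absurd ()

-- Linear inequalities between natural numbers, by reflection

module Linear where

  infixl 7 _⊞_
  infix 6 _≼_
  infix 3 _⊢_

  data Expr (n : ℕ) : Set where
    atom : Fin n → Expr n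
    con  : ℕ → Expr n
    _⊞_  : Expr n → Expr n → Expr n

  data Inequality (n : ℕ) : Set where
    _≼_ : Expr n → Expr n → Inequality n

  data Implication (n : ℕ) : Set where
    _⊢_ : List (Inequality n) → Inequality n → Implication n

  module _ {n : ℕ} where

    ⟦_⟧ : Expr n → Vec ℕ n → ℕ
    ⟦ atom i ⟧ ρ = Vec.lookup ρ i
    ⟦ con c ⟧ ρ  = c
    ⟦ a ⊞ b ⟧ ρ  = ⟦ a ⟧ ρ + ⟦ b ⟧ ρ

    Holds : Vec ℕ n → Inequality n → Set
    Holds ρ (a ≼ b) = ⟦ a ⟧ ρ ≤ ⟦ b ⟧ ρ

    Statement : Vec ℕ n → Implication n → Set
    Statement ρ ([] ⊢ goal)     = Holds ρ goal
    Statement ρ (h ∷ hs ⊢ goal) = Holds ρ h → Statement ρ (hs ⊢ goal)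

  eval : ∀ {n} → Vec ℕ n → Vec ℕ n → ℕ
  eval []       []      = 0
  eval (c ∷ cs) (x ∷ ρ) = c * x + eval cs ρ

  unit : ∀ {n} → Fin n → Vec ℕ n
  unit zero    = 1 ∷ Vec.replicate _ 0
  unit (suc i) = 0 ∷ unit i

  -- The coefficients are to be evaluated at 1 ∷ ρ: the head is the constant term.
  coefficients : ∀ {n} → Expr n → Vec ℕ (suc n)
  coefficients (atom i) = 0 ∷ unit i
  coefficients (con c)  = c ∷ Vec.replicate _ 0
  coefficients (a ⊞ b)  = Vec.zipWith _+_ (coefficients a) (coefficients b)

  eval-0 : ∀ {n} (ρ : Vec ℕ n) → eval (Vec.replicate n 0) ρ ≡ 0
  eval-0 []      = refl
  eval-0 (x ∷ ρ) = eval-0 ρ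

  eval-unit : ∀ {n} (i : Fin n) ρ → eval (unit i) ρ ≡ Vec.lookup ρ i
  eval-unit zero    (x ∷ ρ) = trans (cong₂ _+_ (ℕ.*-identityˡ x) (eval-0 ρ)) (ℕ.+-identityʳ x)
  eval-unit (suc i) (x ∷ ρ) = eval-unit i ρ

  eval-+ : ∀ {n} (cs ds ρ : Vec ℕ n) → eval (Vec.zipWith _+_ cs ds) ρ ≡ eval cs ρ + eval ds ρ
  eval-+ []       []       []      = refl
  eval-+ (c ∷ cs) (d ∷ ds) (x ∷ ρ) = begin
    (c + d) * x + eval (Vec.zipWith _+_ cs ds) ρ ≡⟨ cong₂ _+_ (ℕ.*-distribʳ-+ x c d) (eval-+ cs ds ρ) ⟩
    (c * x + d * x) + (eval cs ρ + eval ds ρ)    ≡⟨ interchange (c * x) (d * x) (eval cs ρ) (eval ds ρ) ⟩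
    (c * x + eval cs ρ) + (d * x + eval ds ρ)    ∎
    where open ≡-Reasoning

  sound : ∀ {n} (e : Expr n) ρ → eval (coefficients e) (1 ∷ ρ) ≡ ⟦ e ⟧ ρ
  sound (atom i) ρ = eval-unit i ρ
  sound (con c)  ρ = trans (cong₂ _+_ (ℕ.*-identityʳ c) (eval-0 ρ)) (ℕ.+-identityʳ c)
  sound (a ⊞ b)  ρ = trans (eval-+ (coefficients a) (coefficients b) (1 ∷ ρ)) (cong₂ _+_ (sound a ρ) (sound b ρ))

  leq : ∀ {n} → Vec ℕ n → Vec ℕ n → Bool
  leq []       []       = true
  leq (c ∷ cs) (d ∷ ds) = (c ≤ᵇ d) ∧ leq cs ds

  leq-sound : ∀ {n} (cs ds ρ : Vec ℕ n) → T (leq cs ds) → eval cs ρ ≤ eval ds ρ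
  leq-sound []       []       []      _ = z≤n
  leq-sound (c ∷ cs) (d ∷ ds) (x ∷ ρ) t with Equivalence.to (T-∧ {c ≤ᵇ d}) t
  ... | c≤d , cs≤ds = ℕ.+-mono-≤ (ℕ.*-monoˡ-≤ x (ℕ.≤ᵇ⇒≤ c d c≤d)) (leq-sound cs ds ρ cs≤ds)

  module _ {n : ℕ} where

    left right : List (Inequality n) → Expr n
    left  []             = con 0
    left  ((a ≼ b) ∷ hs) = a ⊞ left hs
    right []             = con 0
    right ((a ≼ b) ∷ hs) = b ⊞ right hs

    -- It suffices that, with l ≤ r the sum of the hypotheses, the inequality
    -- x + r ≤ y + l holds coefficient by coefficient.
    follows : Implication n → Bool
    follows (hs ⊢ x ≼ y) = leq (coefficients (x ⊞ right hs)) (coefficients (y ⊞ left hs))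

    private
      cancel : ∀ (ρ : Vec ℕ n) x y l r → T (leq (coefficients (x ⊞ r)) (coefficients (y ⊞ l))) →
               ⟦ l ⟧ ρ ≤ ⟦ r ⟧ ρ → ⟦ x ⟧ ρ ≤ ⟦ y ⟧ ρ
      cancel ρ x y l r t l≤r = ℕ.+-cancelʳ-≤ (⟦ l ⟧ ρ) _ _ (begin
        ⟦ x ⟧ ρ + ⟦ l ⟧ ρ                       ≤⟨ ℕ.+-monoʳ-≤ (⟦ x ⟧ ρ) l≤r ⟩
        ⟦ x ⊞ r ⟧ ρ                             ≡⟨ sound (x ⊞ r) ρ ⟨
        eval (coefficients (x ⊞ r)) (1 ∷ ρ)     ≤⟨ leq-sound (coefficients (x ⊞ r)) (coefficients (y ⊞ l)) (1 ∷ ρ) t ⟩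
        eval (coefficients (y ⊞ l)) (1 ∷ ρ)     ≡⟨ sound (y ⊞ l) ρ ⟩
        ⟦ y ⟧ ρ + ⟦ l ⟧ ρ                       ∎)
        where open ≤-Reasoning

      assume : ∀ (ρ : Vec ℕ n) hs goal → (⟦ left hs ⟧ ρ ≤ ⟦ right hs ⟧ ρ → Holds ρ goal) → Statement ρ (hs ⊢ goal)
      assume ρ []             goal f = f z≤n
      assume ρ ((a ≼ b) ∷ hs) goal f = λ h → assume ρ hs goal λ l≤r → f (ℕ.+-mono-≤ h l≤r)

    -- Each hypothesis has weight one, so a call lists exactly the inequalities to be added up; an
    -- impossible system gets the goal `1 ≤ 0`. The atoms appear as bound variables, and the
    -- implicit certificate is found by evaluation, since `T true` is the unit type.
    linear : (ρ : Vec ℕ n) (p : Vec (Expr n) n → Implication n) → let q = p (tabulate atom) in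
             {T (follows q)} → Statement ρ q
    linear ρ p {t} with p (tabulate atom) | t
    ... | hs ⊢ x ≼ y | t = assume ρ hs (x ≼ y) (cancel ρ x y (left hs) (right hs) t)

open Linear using (con; _⊞_; _≼_; _⊢_; linear)

-- Finite vertex sets and their cardinalities

module _ {n : ℕ} where

  comprehension : {P : Fin n → Set} → Decidable P → Subset n
  comprehension P? = tabulate (does ∘ P?)

  ∈-comprehension⁺ : ∀ {P : Fin n → Set} (P? : Decidable P) {v} → P v → v ∈ comprehension P?
  ∈-comprehension⁺ P? {v} Pv =
    lookup⇒[]= v _ (trans (lookup∘tabulate (does ∘ P?) v) (dec-true (P? v) Pv))

  ∈-comprehension⁻ : ∀ {P : Fin n → Set} (P? : Decidable P) {v} → v ∈ comprehension P? → P v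
  ∈-comprehension⁻ P? {v} v∈ with P? v | trans (sym (lookup∘tabulate (does ∘ P?) v)) ([]=⇒lookup v∈)
  ... | yes Pv | _ = Pv
  ... | no _   | ()

-- Opaque copies of the set operations: unlike the originals, they are injective for
-- the unifier, so that sets can be inferred from cardinalities and memberships.
opaque

  # : ∀ {n} → Subset n → ℕ
  # p = Subset.∣ p ∣

  infixr 7 _∩_
  infixr 6 _∪_
  infixl 5 _-_

  _∪_ _∩_ : ∀ {n} → Subset n → Subset n → Subset n
  p ∪ q = p Subset.∪ q
  p ∩ q = p Subset.∩ q

  ∁ : ∀ {n} → Subset n → Subset n
  ∁ p = Subset.∁ p

  ⁅_⁆ : ∀ {n} → Fin n → Subset n
  ⁅ x ⁆ = Subset.⁅ x ⁆

  _-_ : ∀ {n} → Subset n → Fin n → Subset n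
  p - x = p ∩ ∁ ⁅ x ⁆

module _ {n : ℕ} {p : Subset n} where
  opaque
    unfolding #

    #-def : # p ≡ Subset.∣ p ∣
    #-def = refl

    ∈∁⁺ : ∀ {v} → v ∉ p → v ∈ ∁ p
    ∈∁⁺ = Subset.x∉p⇒x∈∁p

    ∈∁⁻ : ∀ {v} → v ∈ ∁ p → v ∉ p
    ∈∁⁻ = Subset.x∈∁p⇒x∉p

    ∣p∣+∣∁p∣≡n : (# p) + (# (∁ p)) ≡ n
    ∣p∣+∣∁p∣≡n = trans (cong ((# p) +_) (Subset.∣∁p∣≡n∸∣p∣ p)) (ℕ.m+[n∸m]≡n (Subset.∣p∣≤n p))

    ∣p∣≡0 : Empty p → (# p) ≡ 0
    ∣p∣≡0 e = trans (cong Subset.∣_∣ (Subset.Empty-unique e)) (Subset.∣⊥∣≡0 n)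

module _ {n : ℕ} {p q : Subset n} where
  opaque
    unfolding #

    mono : (∀ {v} → v ∈ p → v ∈ q) → (# p) ≤ (# q)
    mono f = Subset.p⊆q⇒∣p∣≤∣q∣ f

    ∈∪⁺ : ∀ {v} → v ∈ p ⊎ v ∈ q → v ∈ p ∪ q
    ∈∪⁺ = Subset.x∈p∪q⁺

    ∈∪⁻ : ∀ {v} → v ∈ p ∪ q → v ∈ p ⊎ v ∈ q
    ∈∪⁻ = Subset.x∈p∪q⁻ p q

    ∈∩⁺ : ∀ {v} → v ∈ p → v ∈ q → v ∈ p ∩ q
    ∈∩⁺ v∈p v∈q = Subset.x∈p∩q⁺ (v∈p , v∈q)

    ∈∩⁻ : ∀ {v} → v ∈ p ∩ q → v ∈ p × v ∈ q
    ∈∩⁻ = Subset.x∈p∩q⁻ p q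

    insert≤ : ∀ {x} → (∀ {v} → v ∈ p → v ∈ q) → x ∈ q → x ∉ p → suc (# p) ≤ (# q)
    insert≤ p⊆q x∈q x∉p = Subset.p⊂q⇒∣p∣<∣q∣ (p⊆q , _ , x∈q , x∉p)

module _ {n : ℕ} where
  opaque
    unfolding #

    ∈⁅⁆⁺ : ∀ {x y : Fin n} → x ≡ y → x ∈ ⁅ y ⁆
    ∈⁅⁆⁺ refl = Subset.x∈⁅x⁆ _

    ∈⁅⁆⁻ : ∀ {x y : Fin n} → x ∈ ⁅ y ⁆ → x ≡ y
    ∈⁅⁆⁻ = Subset.x∈⁅y⁆⇒x≡y _

    ∣⁅x⁆∣≡1 : ∀ {x : Fin n} → (# (⁅ x ⁆)) ≡ 1
    ∣⁅x⁆∣≡1 {x} = Subset.∣⁅x⁆∣≡1 x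

    ∈-⁺ : ∀ {p} {x y : Fin n} → x ∈ p → x ≢ y → x ∈ p - y
    ∈-⁺ x∈p x≢y = ∈∩⁺ x∈p (∈∁⁺ (x≢y ∘ ∈⁅⁆⁻))

    ∈-⁻ : ∀ {p} {x y : Fin n} → x ∈ p - y → x ∈ p × x ≢ y
    ∈-⁻ x∈ = let (x∈p , x∉) = ∈∩⁻ x∈ in x∈p , ∈∁⁻ x∉ ∘ ∈⁅⁆⁺

opaque
  unfolding #

  ∣p∪q∣+∣p∩q∣≡∣p∣+∣q∣ : ∀ {n} (p q : Subset n) → (# (p ∪ q)) + (# (p ∩ q)) ≡ (# p) + (# q)
  ∣p∪q∣+∣p∩q∣≡∣p∣+∣q∣ []          []          = refl
  ∣p∪q∣+∣p∩q∣≡∣p∣+∣q∣ (true ∷ p)  (true ∷ q)  =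
    cong suc (trans (ℕ.+-suc _ _) (trans (cong suc (∣p∪q∣+∣p∩q∣≡∣p∣+∣q∣ p q)) (sym (ℕ.+-suc _ _))))
  ∣p∪q∣+∣p∩q∣≡∣p∣+∣q∣ (true ∷ p)  (false ∷ q) = cong suc (∣p∪q∣+∣p∩q∣≡∣p∣+∣q∣ p q)
  ∣p∪q∣+∣p∩q∣≡∣p∣+∣q∣ (false ∷ p) (true ∷ q)  =
    trans (cong suc (∣p∪q∣+∣p∩q∣≡∣p∣+∣q∣ p q)) (sym (ℕ.+-suc _ _))
  ∣p∪q∣+∣p∩q∣≡∣p∣+∣q∣ (false ∷ p) (false ∷ q) = ∣p∪q∣+∣p∩q∣≡∣p∣+∣q∣ p q

module _ {n : ℕ} {p q r : Subset n} where

  cover : (∀ {v} → v ∈ p → v ∈ q ⊎ v ∈ r) → (# p) ≤ (# q) + (# r)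
  cover f = begin
    (# p)                   ≤⟨ mono (∈∪⁺ ∘ f) ⟩
    (# (q ∪ r))               ≤⟨ ℕ.m≤m+n _ _ ⟩
    (# (q ∪ r)) + (# (q ∩ r))   ≡⟨ ∣p∪q∣+∣p∩q∣≡∣p∣+∣q∣ q r ⟩
    (# q) + (# r)           ∎
    where open ≤-Reasoning

  pack : (∀ {v} → v ∈ q → v ∈ p) → (∀ {v} → v ∈ r → v ∈ p) → (∀ {v} → v ∈ q → v ∉ r) →
         (# q) + (# r) ≤ (# p)
  pack q⊆p r⊆p disj = begin
    (# q) + (# r)           ≡⟨ ∣p∪q∣+∣p∩q∣≡∣p∣+∣q∣ q r ⟨
    (# (q ∪ r)) + (# (q ∩ r))   ≡⟨ cong ((# (q ∪ r)) +_) (∣p∣≡0 λ { (_ , v∈) → let (v∈q , v∈r) = ∈∩⁻ v∈ in disj v∈q v∈r }) ⟩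
    (# (q ∪ r)) + 0           ≡⟨ ℕ.+-identityʳ _ ⟩
    (# (q ∪ r))               ≤⟨ mono ([ q⊆p , r⊆p ]′ ∘ ∈∪⁻) ⟩
    (# p)                   ∎
    where open ≤-Reasoning

module _ {n : ℕ} where

  cover₁ : ∀ {p q : Subset n} x → (∀ {v} → v ∈ p → v ≡ x ⊎ v ∈ q) → (# p) ≤ suc (# q)
  cover₁ {p} {q} x f = subst (λ m → (# p) ≤ m + (# q)) ∣⁅x⁆∣≡1
    (cover λ v∈ → [ inj₁ ∘ ∈⁅⁆⁺ , inj₂ ]′ (f v∈))

  ∣p∣≤1 : ∀ {p : Subset n} x → (∀ {v} → v ∈ p → v ≡ x) → (# p) ≤ 1
  ∣p∣≤1 {p} x f = subst ((# p) ≤_) ∣⁅x⁆∣≡1 (mono (∈⁅⁆⁺ ∘ f))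

  1≤∣p∣ : ∀ {p : Subset n} {v} → v ∈ p → 1 ≤ (# p)
  1≤∣p∣ {p} {v} v∈p = subst (_≤ (# p)) ∣⁅x⁆∣≡1
    (mono λ x∈ → subst (_∈ p) (sym (∈⁅⁆⁻ x∈)) v∈p)

  2≤∣p∣ : ∀ {p : Subset n} {x y} → x ∈ p → y ∈ p → x ≢ y → 2 ≤ (# p)
  2≤∣p∣ {p} {x} {y} x∈ y∈ x≢y = subst (λ m → suc m ≤ (# p)) ∣⁅x⁆∣≡1
    (insert≤ (λ v∈ → subst (_∈ p) (sym (∈⁅⁆⁻ v∈)) x∈) y∈ (λ y∈⁅x⁆ → x≢y (sym (∈⁅⁆⁻ y∈⁅x⁆))))

  ∣p∣≤1⇒≡ : ∀ {p : Subset n} {x y} → (# p) ≤ 1 → x ∈ p → y ∈ p → x ≡ y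
  ∣p∣≤1⇒≡ {x = x} {y} small x∈ y∈ with x Fin.≟ y
  ... | yes eq = eq
  ... | no neq = contradiction (≤-trans (2≤∣p∣ x∈ y∈ neq) small) λ { (s≤s ()) }

  split : ∀ {p : Subset n} x {v} → v ∈ p → v ≡ x ⊎ v ∈ p - x
  split x {v} v∈ with v Fin.≟ x
  ... | yes eq = inj₁ eq
  ... | no neq = inj₂ (∈-⁺ v∈ neq)

  ∣-∣ : ∀ {p : Subset n} {x} → x ∈ p → suc (# (p - x)) ≡ (# p)
  ∣-∣ {p} {x} x∈p = ℕ.≤-antisym
    (insert≤ (proj₁ ∘ ∈-⁻) x∈p (λ x∈ → proj₂ (∈-⁻ x∈) refl))
    (cover₁ x (split x))

  1≤∣p∣⁻ : ∀ {p : Subset n} → 1 ≤ (# p) → Nonempty p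
  1≤∣p∣⁻ {p} h with nonempty? p
  ... | yes ne = ne
  ... | no e = contradiction (subst (1 ≤_) (∣p∣≡0 e) h) λ ()

  another : ∀ {p : Subset n} → 2 ≤ (# p) → ∀ x → ∃ λ y → y ∈ p × y ≢ x
  another {p} h x with 1≤∣p∣⁻ {p - x} (ℕ.≤-pred (≤-trans h (cover₁ x (split x))))
  ... | y , y∈ = y , ∈-⁻ y∈

  -- Turns tight counts into adjacency: applied to the neighbours inside `q`, it shows that none of
  -- `q` is missed.
  trapped : ∀ {p q : Subset n} → (∀ {v} → v ∈ p → v ∈ q) → (# q) ≤ (# p) → ∀ {v} → v ∈ q → v ∈ p
  trapped {p} p⊆q h {v} v∈q with v ∈? p
  ... | yes v∈p = v∈p
  ... | no v∉p  = contradiction (≤-trans (insert≤ p⊆q v∈q v∉p) h) (ℕ.<-irrefl refl)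

-- Separations and submodularity

module Separations {n : ℕ} (k : ℕ) (H : Graph (Fin n)) where
  open Graph H

  -- k-connectivity in terms of separations: A and B are what remains, on the two
  -- sides, after deleting the vertices outside A ∪ B.
  CutBound : Set
  CutBound = ∀ {A B} → Nonempty A → Nonempty B → (∀ {v} → v ∈ A → v ∉ B) →
             (∀ {a b} → a ∈ A → b ∈ B → ¬ a ~ b) → # A + # B + k ≤ n

  -- A separation witnessing that the graph without the edge xy is not k-connected.
  record Critical (x y : Fin n) (A B : Subset n) : Set where
    field
      x∈       : x ∈ A
      y∈       : y ∈ B
      disjoint : ∀ {v} → v ∈ A → v ∉ B
      only     : ∀ {a b} → a ∈ A → b ∈ B → a ~ b → a ≡ x × b ≡ y
      large    : suc n ≤ # A + # B + k

    ∣A∪B∣ : (# (A ∪ B)) ≡ # A + (# B)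
    ∣A∪B∣ = trans (sym (ℕ.+-identityʳ _))
      (trans (cong ((# (A ∪ B)) +_) (sym (∣p∣≡0 λ { (_ , v∈) → let (v∈A , v∈B) = ∈∩⁻ v∈ in disjoint v∈A v∈B })))
        (∣p∪q∣+∣p∩q∣≡∣p∣+∣q∣ A B))

    ∣rest∣ : # A + # B + (# (∁ (A ∪ B))) ≡ n
    ∣rest∣ = trans (cong (_+ (# (∁ (A ∪ B)))) (sym ∣A∪B∣)) ∣p∣+∣∁p∣≡n

    ∣rest∣<k : suc (# (∁ (A ∪ B))) ≤ k
    ∣rest∣<k = linear (n ∷ # A ∷ # B ∷ # (∁ (A ∪ B)) ∷ k ∷ [])
        (λ { (n ∷ a ∷ b ∷ c ∷ k ∷ []) →
            con 1 ⊞ n ≼ a ⊞ b ⊞ k ∷ a ⊞ b ⊞ c ≼ n ∷ []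
            ⊢ con 1 ⊞ c ≼ k })
        large (≤-reflexive ∣rest∣)

  opaque

    N : Fin n → Subset n
    N u = neighbours H u

    ∈N⁺ : ∀ {u v} → u ~ v → v ∈ N u
    ∈N⁺ {u} = ∈-comprehension⁺ (u ~?_)

    ∈N⁻ : ∀ {u v} → v ∈ N u → u ~ v
    ∈N⁻ {u} = ∈-comprehension⁻ (u ~?_)

    ∣N∣≡degree : ∀ {u} → # (N u) ≡ degree H u
    ∣N∣≡degree = #-def

  -- If `y` were alone in `B`, its neighbours would be `x` and the fewer than `k` vertices outside
  -- `A ∪ B`, at most `k` in all.
  critical-side : ∀ {x y A B} → Critical x y A B → suc k ≤ (# (N y)) → 2 ≤ (# B)
  critical-side {x} {y} {A} {B} c deg with 2 ℕ.≤? (# B)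
  ... | yes h = h
  ... | no ¬h = absurd (linear (k ∷ # (∁ (A ∪ B)) ∷ # (N y) ∷ [])
      (λ { (k ∷ a ∷ b ∷ []) →
          con 1 ⊞ k ≼ b ∷ con 1 ⊞ a ≼ k ∷ b ≼ con 1 ⊞ a ∷ []
          ⊢ con 1 ≼ con 0 })
      deg ∣rest∣<k deg≤)
    where
    open Critical c
    nbr : ∀ v → y ~ v → v ≡ x ⊎ v ∈ ∁ (A ∪ B)
    nbr v y~v with v ∈? A | v ∈? B
    ... | yes v∈A | _ = inj₁ (proj₁ (only v∈A y∈ (~-sym y~v)))
    ... | no _ | yes v∈B = contradiction y~v (~-irrefl (∣p∣≤1⇒≡ (ℕ.≤-pred (ℕ.≰⇒> ¬h)) y∈ v∈B))
    ... | no v∉A | no v∉B = inj₂ (∈∁⁺ λ v∈ → [ v∉A , v∉B ]′ (∈∪⁻ v∈))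

    deg≤ : # (N y) ≤ suc (# (∁ (A ∪ B)))
    deg≤ = cover₁ x λ {v} v∈ → nbr v (∈N⁻ v∈)

  module _ (kc : CutBound) where

    -- Submodularity for the two separations: B ∩ A′ meets its bound up to the vertex y,
    -- so A ∩ B′ would be too large for kc and must be empty.
    descent : ∀ {x y z A B A′ B′} → Critical x y A B → Critical y z A′ B′ → x ≢ z →
              suc k ≤ (# (N y)) → suc (# B′) ≤ (# B)
    descent {x} {y} {z} {A} {B} {A′} {B′} c c′ x≢z deg =
      linear (# (B ∩ A′) ∷ # (A ∪ B′) ∷ k ∷ # A ∷ # B′ ∷ n ∷ # (A ∩ B′) ∷ # B ∷ [])
          (λ { (a ∷ b ∷ k ∷ c ∷ e ∷ n ∷ f ∷ g ∷ []) →
              a ⊞ b ⊞ k ≼ con 1 ⊞ n ∷ c ⊞ e ≼ b ⊞ f ∷ con 1 ⊞ n ≼ c ⊞ g ⊞ k ∷ con 1 ≼ a ∷ f ≼ con 0 ∷ []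
              ⊢ con 1 ⊞ e ≼ g })
          bound (≤-reflexive (sym modular)) C.large (1≤∣p∣ (∈∩⁺ C.y∈ C′.x∈))
          (≤-reflexive ∣A∩B′∣≡0)
      where
      module C  = Critical c
      module C′ = Critical c′

      modular : # (A ∪ B′) + # (A ∩ B′) ≡ # A + # B′
      modular = ∣p∪q∣+∣p∩q∣≡∣p∣+∣q∣ A B′

      modular′ : # (B ∪ A′) + # (B ∩ A′) ≡ # B + # A′
      modular′ = ∣p∪q∣+∣p∩q∣≡∣p∣+∣q∣ B A′

      y∉A∪B′ : y ∉ A ∪ B′
      y∉A∪B′ y∈ = [ (λ y∈A → C.disjoint y∈A C.y∈) , C′.disjoint C′.x∈ ]′ (∈∪⁻ y∈)

      neighbour : ∀ {v} → y ~ v → v ∈ A ∪ B′ → v ≡ x ⊎ v ≡ z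
      neighbour y~v v∈ with ∈∪⁻ v∈
      ... | inj₁ v∈A  = inj₁ (proj₁ (C.only v∈A C.y∈ (~-sym y~v)))
      ... | inj₂ v∈B′ = inj₂ (proj₂ (C′.only C′.x∈ v∈B′ y~v))

      -- Every edge from `B ∩ A′` to `A ∪ B′` starts at `y`, so `kc` applies once `y` is removed,
      -- unless nothing remains. In that case all neighbours of `y` except `x` and `z` lie outside
      -- `A ∪ B′`, and there are at least `k - 1` of them.
      bound : (# (B ∩ A′)) + (# (A ∪ B′)) + k ≤ suc n
      bound with nonempty? ((B ∩ A′) - y)
      ... | yes ne = subst (λ m → m + (# (A ∪ B′)) + k ≤ suc n) (∣-∣ (∈∩⁺ C.y∈ C′.x∈))
        (s≤s (kc ne (x , ∈∪⁺ (inj₁ C.x∈))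
          (λ v∈ v∈′ → let (v∈B , v∈A′) = ∈∩⁻ (proj₁ (∈-⁻ v∈)) in
            [ (λ v∈A → C.disjoint v∈A v∈B) , C′.disjoint v∈A′ ]′ (∈∪⁻ v∈′))
          λ a∈ b∈ a~b → let (a∈′ , a≢y) = ∈-⁻ a∈ ; (a∈B , a∈A′) = ∈∩⁻ a∈′ in
            [ (λ b∈A → a≢y (proj₂ (C.only b∈A a∈B (~-sym a~b))))
            , (λ b∈B′ → a≢y (proj₁ (C′.only a∈A′ b∈B′ a~b))) ]′ (∈∪⁻ b∈)))
      ... | no empty = linear (k ∷ # (N y) ∷ # (B ∩ A′) ∷ # (∁ (A ∪ B′) - y) ∷ # (A ∪ B′) ∷ # (∁ (A ∪ B′)) ∷ n ∷ [])
          (λ { (k ∷ a ∷ b ∷ c ∷ e ∷ f ∷ n ∷ []) →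
              con 1 ⊞ k ≼ a ∷ a ≼ con 2 ⊞ c ∷ b ≼ con 1 ∷ con 1 ⊞ c ≼ f ∷ e ⊞ f ≼ n ∷ []
              ⊢ b ⊞ e ⊞ k ≼ con 1 ⊞ n })
          deg deg≤ one (≤-reflexive (∣-∣ (∈∁⁺ y∉A∪B′)))
          (≤-reflexive (∣p∣+∣∁p∣≡n {p = A ∪ B′}))
        where
        one : # (B ∩ A′) ≤ 1
        one = ∣p∣≤1 y λ {v} v∈ → [ (λ e → e) , (λ v∈′ → contradiction (v , v∈′) empty) ]′ (split y v∈)

        other : ∀ {v} → v ∈ N y - x → v ≡ z ⊎ v ∈ ∁ (A ∪ B′) - y
        other {v} v∈ with v Fin.≟ z | ∈-⁻ v∈
        ... | yes v≡z | _ = inj₁ v≡z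
        ... | no v≢z | v∈N , v≢x = inj₂ (∈-⁺ (∈∁⁺ λ v∈∪ → [ v≢x , v≢z ]′ (neighbour (∈N⁻ v∈N) v∈∪))
                                              (λ v≡y → ~-irrefl (sym v≡y) (∈N⁻ v∈N)))

        deg≤ : # (N y) ≤ 2 + # (∁ (A ∪ B′) - y)
        deg≤ = ≤-trans (cover₁ x (split x)) (s≤s (cover₁ z other))

      ∣A∩B′∣≡0 : # (A ∩ B′) ≡ 0
      ∣A∩B′∣≡0 = ∣p∣≡0 λ { (v , v∈) → absurd (let
          opposite : # (A ∩ B′) + # (B ∪ A′) + k ≤ n
          opposite = kc (v , v∈) (y , ∈∪⁺ (inj₁ C.y∈))
            (λ v∈ v∈′ → let (v∈A , v∈B′) = ∈∩⁻ v∈ in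
              [ C.disjoint v∈A , (λ v∈A′ → C′.disjoint v∈A′ v∈B′) ]′ (∈∪⁻ v∈′))
            noEdge
        in linear (# (B ∩ A′) ∷ # (A ∪ B′) ∷ k ∷ # (A ∩ B′) ∷ # (B ∪ A′) ∷ # A ∷ # B′ ∷ # B ∷ # A′ ∷ n ∷ [])
            (λ { (a ∷ b ∷ k ∷ c ∷ e ∷ f ∷ g ∷ h ∷ p ∷ n ∷ []) →
                a ⊞ b ⊞ k ≼ con 1 ⊞ n ∷ c ⊞ e ⊞ k ≼ n ∷ f ⊞ g ≼ b ⊞ c ∷ h ⊞ p ≼ e ⊞ a ∷ con 1 ⊞ n ≼ f ⊞ h ⊞ k ∷ con 1 ⊞ n ≼ p ⊞ g ⊞ k ∷ []
                ⊢ con 1 ≼ con 0 })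
            bound opposite (≤-reflexive (sym modular)) (≤-reflexive (sym modular′))
            C.large C′.large) }
        where
        -- A crossing edge would be `xy` with `x` in `B′` or `yz` with `z` in `A`. It would cross
        -- the other separation as well, and its uniqueness there forces `x ≡ z`.
        noEdge : ∀ {a b} → a ∈ A ∩ B′ → b ∈ B ∪ A′ → ¬ a ~ b
        noEdge a∈ b∈ a~b with ∈∩⁻ a∈ | ∈∪⁻ b∈
        ... | a∈A , a∈B′ | inj₁ b∈B with C.only a∈A b∈B a~b
        ...   | refl , refl = x≢z (proj₂ (C′.only C′.x∈ a∈B′ (~-sym a~b)))
        noEdge a∈ b∈ a~b | a∈A , a∈B′ | inj₂ b∈A′ with C′.only b∈A′ a∈B′ (~-sym a~b)
        ...   | refl , refl = x≢z (sym (proj₁ (C.only a∈A C.y∈ a~b)))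

-- Leaves and paths in the forest `H[U]`

module Forest {n : ℕ} (k : ℕ) (H : Graph (Fin n)) (kc : Separations.CutBound k H) (U : Subset n)
  (degree≥ : ∀ {u} → u ∈ U → suc k ≤ # (Separations.N k H u))
  (critical : ∀ {u v} → u ∈ U → v ∈ U → Graph._~_ H u v → ∃₂ (Separations.Critical k H u v))
  where
  open Graph H
  open Separations k H public

  _⊆U : Subset n → Set
  X ⊆U = ∀ {v} → v ∈ X → v ∈ U

  record Leaf (X : Subset n) (v : Fin n) : Set where
    constructor leaf
    field
      inside : v ∈ X
      small  : # (X ∩ N v) ≤ 1

  open Leaf

  -- Along a walk which does not turn back, the far sides of the separations shrink.
  walk : ∀ m {X x y A B} → X ⊆U → x ∈ X → y ∈ X → x ~ y → Critical x y A B → # B ≤ m →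
         ∃ λ v → Leaf X v × ∃ λ w → w ∈ X × v ~ w
  walk zero    X⊆U x∈ y∈ x~y c h = absurd (≤-trans (1≤∣p∣ (Critical.y∈ c)) h)
  walk (suc m) {X} {x} {y} X⊆U x∈X y∈X x~y c h with # (X ∩ N y) ℕ.≤? 1
  ... | yes small = y , leaf y∈X small , x , x∈X , ~-sym x~y
  ... | no ¬small with another (ℕ.≰⇒> ¬small) x
  ...   | z , z∈ , z≢x with ∈∩⁻ z∈
  ...     | z∈X , z∈N with critical (X⊆U y∈X) (X⊆U z∈X) (∈N⁻ z∈N)
  ...       | A′ , B′ , c′ = walk m X⊆U y∈X z∈X (∈N⁻ z∈N) c′
    (ℕ.≤-pred (≤-trans (descent kc c c′ (z≢x ∘ sym) (degree≥ (X⊆U y∈X))) h))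

  edgeLeaf : ∀ {X x y} → X ⊆U → x ∈ X → y ∈ X → x ~ y → ∃ λ v → Leaf X v × ∃ λ w → w ∈ X × v ~ w
  edgeLeaf X⊆U x∈ y∈ x~y with critical (X⊆U x∈) (X⊆U y∈) x~y
  ... | A , B , c = walk _ X⊆U x∈ y∈ x~y c ≤-refl

  -- Holding for all subsets `X` of `U`, this expresses acyclicity: the vertices of a cycle would be
  -- a set without such a vertex.
  forest : ∀ {X} → X ⊆U → Nonempty X → ∃ (Leaf X)
  forest {X} X⊆U (v , v∈X) with # (X ∩ N v) ℕ.≤? 1
  ... | yes small = v , leaf v∈X small
  ... | no ¬small with another (ℕ.≰⇒> ¬small) v
  ...   | w , w∈ , _ with ∈∩⁻ w∈
  ...     | w∈X , w∈N with edgeLeaf X⊆U v∈X w∈X (∈N⁻ w∈N)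
  ...       | u , uleaf , _ = u , uleaf

  keep : ∀ {X a v} → ¬ a ~ v → # (X ∩ N v) ≤ # ((X - a) ∩ N v)
  keep {a = a} {v} a≁v = mono λ {w} w∈ → let (w∈X , w∈N) = ∈∩⁻ w∈ in
    ∈∩⁺ (∈-⁺ w∈X λ { refl → a≁v (~-sym (∈N⁻ w∈N)) }) w∈N

  -- The usual induction for a second leaf. If `a` is itself a leaf with neighbour `c`, a leaf of
  -- `X - a` other than `c` is not adjacent to `a` and hence stays a leaf; if `c` is all that
  -- remains, `c` is one. The number `m` only bounds the recursion.
  otherLeaf : ∀ m {X a} → # X ≤ m → X ⊆U → a ∈ X → (∀ {v} → v ∈ X → v ≡ a) ⊎ ∃ λ v → Leaf X v × v ≢ a
  otherLeaf zero    h X⊆U a∈X = absurd (≤-trans (1≤∣p∣ a∈X) h)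
  otherLeaf (suc m) {X} {a} h X⊆U a∈X with forest X⊆U (a , a∈X)
  ... | v , vleaf with v Fin.≟ a
  ...   | no v≢a   = inj₂ (v , vleaf , v≢a)
  ...   | yes refl with nonempty? (X ∩ N a) | nonempty? (X - a)
  ...     | _ | no alone = inj₁ λ {v} v∈ → [ (λ e → e) , (λ v∈′ → contradiction (v , v∈′) alone) ]′ (split a v∈)
  ...     | no isolated | yes rest with forest {X - a} (X⊆U ∘ proj₁ ∘ ∈-⁻) rest
  ...       | v , leaf v∈ small with ∈-⁻ v∈
  ...         | v∈X , v≢a = inj₂ (v , leaf v∈X (≤-trans (keep λ a~v → isolated (v , ∈∩⁺ v∈X (∈N⁺ a~v))) small) , v≢a)
  otherLeaf (suc m) {X} {a} h X⊆U a∈X | v , vleaf | yes refl | yes (c , c∈) | yes rest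
    with ∈∩⁻ c∈
  ... | c∈X , c∈N with (λ (c≡a : c ≡ a) → ~-irrefl (sym c≡a) (∈N⁻ c∈N))
  ...   | c≢a with otherLeaf m {X - a} {c} (ℕ.≤-pred (subst (_≤ suc m) (sym (∣-∣ a∈X)) h)) (X⊆U ∘ proj₁ ∘ ∈-⁻) (∈-⁺ c∈X c≢a)
  ...     | inj₁ onlyc = inj₂ (c , leaf c∈X (∣p∣≤1 a λ {w} w∈ → let (w∈X , w∈N) = ∈∩⁻ w∈ in
              [ (λ e → e) , (λ w∈′ → contradiction (∈N⁻ w∈N) (~-irrefl (sym (onlyc w∈′)))) ]′ (split a w∈X)) , c≢a)
  ...     | inj₂ (v , leaf v∈ small , v≢c) with ∈-⁻ v∈
  ...       | v∈X , v≢a = inj₂ (v , leaf v∈X (≤-trans (keep λ a~v →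
              v≢c (∣p∣≤1⇒≡ (Leaf.small vleaf) (∈∩⁺ v∈X (∈N⁺ a~v)) c∈)) small) , v≢a)

  secondLeaf : ∀ {X a} → X ⊆U → a ∈ X → (∀ {v} → v ∈ X → v ≡ a) ⊎ ∃ λ v → Leaf X v × v ≢ a
  secondLeaf = otherLeaf _ ≤-refl

  -- Degree conditions that make a forest a path: only `p` and `s` can be leaves, and `end` keeps
  -- `s` from being isolated. That `p` has a neighbour follows.
  record PathLike (X : Subset n) (p s : Fin n) : Set where
    field
      ⊆U    : X ⊆U
      first : p ∈ X
      last  : s ∈ X
      inner : ∀ {v} → v ∈ X → v ≢ p → v ≢ s → 2 ≤ # (X ∩ N v)
      end   : s ≢ p → 1 ≤ # (X ∩ N s)

  -- The values of `at` from position `# X` on are junk; `steps` makes the path induced.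
  record Path (X : Subset n) (p s : Fin n) : Set where
    field
      at         : ℕ → Fin n
      first      : at 0 ≡ p
      last       : ∀ {i} → suc i ≡ # X → at i ≡ s
      inside     : ∀ {i} → i < # X → at i ∈ X
      exhaustive : ∀ {v} → v ∈ X → ∃ λ i → i < # X × at i ≡ v
      injective  : ∀ {i j} → i < j → j < # X → at i ≢ at j
      step       : ∀ {i} → suc i < # X → at i ~ at (suc i)
      steps      : ∀ {i j} → i < j → j < # X → at i ~ at j → j ≡ suc i

  -- Peels off `p`. The leaf of `X` besides `s` can only be `p`, so `p` has at most one neighbour. A
  -- leaf of `X - p` besides `s` must have lost a neighbour, so `p` has one, and it starts the
  -- remaining path.
  path : ∀ m {X p s} → # X ≤ m → PathLike X p s → Path X p s
  path zero h pl = absurd (≤-trans (1≤∣p∣ (PathLike.first pl)) h)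
  path (suc m) {X} {p} {s} h pl with nonempty? (X - p)
  ... | no alone = record
    { at         = λ _ → p
    ; first      = refl
    ; last       = λ _ → sym (only PL.last)
    ; inside     = λ _ → PL.first
    ; exhaustive = λ v∈ → 0 , 1≤∣p∣ PL.first , sym (only v∈)
    ; injective  = λ {i} {j} i<j j<X _ → absurd (linear (i ∷ j ∷ # X ∷ [])
        (λ { (i ∷ j ∷ a ∷ []) →
            con 1 ⊞ i ≼ j ∷ con 1 ⊞ j ≼ a ∷ a ≼ con 1 ∷ []
            ⊢ con 1 ≼ con 0 })
        i<j j<X X≤1)
    ; step       = λ {i} i<X → absurd (linear (i ∷ # X ∷ [])
        (λ { (i ∷ a ∷ []) →
            con 2 ⊞ i ≼ a ∷ a ≼ con 1 ∷ []
            ⊢ con 1 ≼ con 0 })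
        i<X X≤1)
    ; steps      = λ {i} {j} i<j j<X _ → absurd (linear (i ∷ j ∷ # X ∷ [])
        (λ { (i ∷ j ∷ a ∷ []) →
            con 1 ⊞ i ≼ j ∷ con 1 ⊞ j ≼ a ∷ a ≼ con 1 ∷ []
            ⊢ con 1 ≼ con 0 })
        i<j j<X X≤1)
    }
    where
    module PL = PathLike pl
    only : ∀ {v} → v ∈ X → v ≡ p
    only {v} v∈ = [ (λ e → e) , (λ v∈′ → contradiction (v , v∈′) alone) ]′ (split p v∈)
    X≤1 : # X ≤ 1
    X≤1 = ∣p∣≤1 p only
  ... | yes (r , r∈) = record
    { at         = at
    ; first      = refl
    ; last       = last
    ; inside     = inside′
    ; exhaustive = exhaustive
    ; injective  = injective
    ; step       = step
    ; steps      = steps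
    }
    where
    module PL = PathLike pl
    X′ : Subset n
    X′ = X - p

    X′⊆X : ∀ {v} → v ∈ X′ → v ∈ X
    X′⊆X = proj₁ ∘ ∈-⁻

    size : suc (# X′) ≡ # X
    size = ∣-∣ PL.first

    s≢p : s ≢ p
    s≢p refl with secondLeaf PL.⊆U PL.first
    ... | inj₁ only = proj₂ (∈-⁻ r∈) (only (X′⊆X r∈))
    ... | inj₂ (v , leaf v∈ small , v≢p) = absurd (ℕ.≤-pred (≤-trans (PL.inner v∈ v≢p v≢p) small))

    s∈X′ : s ∈ X′
    s∈X′ = ∈-⁺ PL.last s≢p

    next : ∃ λ q → q ∈ X′ × p ~ q
    next with secondLeaf {X′} (PL.⊆U ∘ X′⊆X) s∈X′
    ... | inj₁ only with 1≤∣p∣⁻ (PL.end s≢p)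
    ...   | w , w∈ with ∈∩⁻ w∈
    ...     | w∈X , w∈N with w Fin.≟ p
    ...       | yes refl = s , s∈X′ , ~-sym (∈N⁻ w∈N)
    ...       | no w≢p   = contradiction (∈N⁻ w∈N) (~-irrefl (sym (only (∈-⁺ w∈X w≢p))))
    next | inj₂ (v , leaf v∈ small , v≢s) with p ~? v
    ... | yes p~v = v , v∈ , p~v
    ... | no p≁v  = absurd (ℕ.≤-pred (≤-trans (PL.inner (X′⊆X v∈) (proj₂ (∈-⁻ v∈)) v≢s) (≤-trans (keep p≁v) small)))

    q : Fin n
    q = proj₁ next
    q∈X′ : q ∈ X′
    q∈X′ = proj₁ (proj₂ next)
    p~q : p ~ q
    p~q = proj₂ (proj₂ next)

    unique : ∀ {v} → v ∈ X → p ~ v → v ≡ q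
    unique v∈ p~v with secondLeaf PL.⊆U PL.last
    ... | inj₁ only = contradiction (sym (only PL.first)) s≢p
    ... | inj₂ (w , leaf w∈ small , w≢s) with w Fin.≟ p
    ...   | yes refl = ∣p∣≤1⇒≡ small (∈∩⁺ v∈ (∈N⁺ p~v)) (∈∩⁺ (X′⊆X q∈X′) (∈N⁺ p~q))
    ...   | no w≢p   = absurd (ℕ.≤-pred (≤-trans (PL.inner w∈ w≢p w≢s) small))

    tail : Path X′ q s
    tail = path m (ℕ.≤-pred (subst (_≤ suc m) (sym size) h)) record
      { ⊆U    = PL.⊆U ∘ X′⊆X
      ; first = q∈X′
      ; last  = s∈X′
      ; inner = λ {v} v∈ v≢q v≢s → ≤-trans (PL.inner (X′⊆X v∈) (proj₂ (∈-⁻ v∈)) v≢s)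
                  (keep λ p~v → v≢q (unique (X′⊆X v∈) p~v))
      ; end   = λ s≢q → ≤-trans (PL.end s≢p) (keep λ p~s → s≢q (unique PL.last p~s))
      }
    module T = Path tail

    at : ℕ → Fin n
    at zero    = p
    at (suc i) = T.at i

    shrink : ∀ {i} → suc i < # X → i < # X′
    shrink i< = ℕ.≤-pred (subst (_ ≤_) (sym size) i<)

    last : ∀ {i} → suc i ≡ # X → at i ≡ s
    last {zero}  e = contradiction r∈ λ r∈ → absurd (≤-trans (1≤∣p∣ r∈) (≤-reflexive (ℕ.suc-injective (trans size (sym e)))))
    last {suc i} e = T.last (ℕ.suc-injective (trans e (sym size)))

    inside′ : ∀ {i} → i < # X → at i ∈ X
    inside′ {zero}  _  = PL.first
    inside′ {suc i} i< = X′⊆X (T.inside (shrink i<))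

    exhaustive : ∀ {v} → v ∈ X → ∃ λ i → i < # X × at i ≡ v
    exhaustive v∈ with split p v∈
    ... | inj₁ refl = 0 , 1≤∣p∣ PL.first , refl
    ... | inj₂ v∈′ with T.exhaustive v∈′
    ...   | i , i< , e = suc i , subst (suc i <_) size (s≤s i<) , e

    injective : ∀ {i j} → i < j → j < # X → at i ≢ at j
    injective {zero}  {suc j} _ j< e = proj₂ (∈-⁻ (T.inside (shrink j<))) (sym e)
    injective {suc i} {suc j} (s≤s i<j) j< e = T.injective i<j (shrink j<) e

    step : ∀ {i} → suc i < # X → at i ~ at (suc i)
    step {zero}  _  = subst (p ~_) (sym T.first) p~q
    step {suc i} i< = T.step (shrink i<)

    steps : ∀ {i j} → i < j → j < # X → at i ~ at j → j ≡ suc i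
    steps {zero} {suc zero}    _ _  _   = refl
    steps {zero} {suc (suc j)} _ j< p~v = contradiction
      (trans T.first (sym (unique (inside′ {suc (suc j)} j<) p~v))) (T.injective (s≤s z≤n) (shrink j<))
    steps {suc i} {suc j} (s≤s i<j) j< e = cong suc (T.steps i<j (shrink j<) e)

  pathLike⇒path : ∀ {X p s} → PathLike X p s → Path X p s
  pathLike⇒path = path _ ≤-refl

  -- Each step along the path shrinks the far side by at least one vertex (`descent`), and the last
  -- far side still has two (`critical-side`).
  longPath : ∀ {X t p s A B} → PathLike X p s → Critical t p A B → t ∉ X → suc (# X) ≤ # B
  longPath {X} {t} {p} {s} {A} {B} pl c t∉X = bound
    where
    module P = Path (pathLike⇒path pl)
    ⊆U = PathLike.⊆U pl
    -- The predecessor `u` of position `i` is recorded as different from the successor, as `descent`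
    -- requires for the next step.
    along : ∀ i → i < # X →
      ∃ λ u → (suc i < # X → u ≢ P.at (suc i)) × ∃₂ λ A′ B′ → Critical u (P.at i) A′ B′ × # B′ + i ≤ # B
    along zero    i< = t , (λ i< e → t∉X (subst (_∈ X) (sym e) (P.inside i<))) , A , B ,
      subst (λ p → Critical t p A B) (sym P.first) c , ≤-reflexive (ℕ.+-identityʳ _)
    along (suc i) i< with along i (ℕ.<-trans (ℕ.n<1+n i) i<)
    ... | u , u≢ , A′ , B′ , c′ , h
      with critical (⊆U (P.inside (ℕ.<-trans (ℕ.n<1+n i) i<))) (⊆U (P.inside i<)) (P.step i<)
    ...   | A″ , B″ , c″ = P.at i , (λ i+2< → P.injective (ℕ.<-trans (ℕ.n<1+n i) (ℕ.n<1+n (suc i))) i+2<) , A″ , B″ , c″ ,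
            (let d : suc (# B″) ≤ # B′
                 d = descent kc c′ c″ (u≢ i<) (degree≥ (⊆U (P.inside (ℕ.<-trans (ℕ.n<1+n i) i<))))
             in linear (# B″ ∷ # B′ ∷ i ∷ # B ∷ [])
                 (λ { (a ∷ b ∷ i ∷ c ∷ []) →
                     con 1 ⊞ a ≼ b ∷ b ⊞ i ≼ c ∷ []
                     ⊢ a ⊞ (con 1 ⊞ i) ≼ c })
                 d h)
    pred : ∃ λ i → # X ≡ suc i
    pred with # X | 1≤∣p∣ (PathLike.first pl)
    ... | suc i | _ = i , refl
    bound : suc (# X) ≤ # B
    bound with pred
    ... | i , size with along i (≤-reflexive (sym size))
    ...   | u , _ , A′ , B′ , c′ , h =
      let two : 2 ≤ # B′
          two = critical-side c′ (degree≥ (⊆U (P.inside (≤-reflexive (sym size)))))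
      in linear (# X ∷ # B′ ∷ i ∷ # B ∷ [])
          (λ { (a ∷ b ∷ i ∷ c ∷ []) →
              a ≼ con 1 ⊞ i ∷ con 2 ≼ b ∷ b ⊞ i ≼ c ∷ []
              ⊢ con 1 ⊞ a ≼ c })
          (≤-reflexive size) two h

-- Neighbour counts at leaves and the resulting structure

module Structure {n : ℕ} (k d : ℕ) (k<d : suc k ≤ d) (H : Graph (Fin n)) (kc : Separations.CutBound k H)
  (U : Subset n) (∣W∣≤d : # (∁ U) ≤ d)
  (degree≥d : ∀ {u} → u ∈ U → d ≤ # (Separations.N k H u))
  (degree≥k : ∀ v → k ≤ # (Separations.N k H v))
  (critical : ∀ {u v} → u ∈ U → v ∈ U → Graph._~_ H u v → ∃₂ (Separations.Critical k H u v))
  where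
  open Graph H
  open Forest k H kc U (λ u∈ → ≤-trans k<d (degree≥d u∈)) critical public

  W : Subset n
  W = ∁ U

  clash : ∀ {ℓ} {A : Set ℓ} {v} → v ∈ U → v ∈ W → A
  clash v∈U v∈W = contradiction v∈U (∈∁⁻ v∈W)

  side : ∀ v → v ∈ U ⊎ v ∈ W
  side v with v ∈? U
  ... | yes v∈U = inj₁ v∈U
  ... | no v∉U  = inj₂ (∈∁⁺ v∉U)

  -- A leaf g of U and its neighbour p in U, with a separation L, P for the edge gp. It
  -- turns out that W has one vertex ν in P, one vertex μ in L, and its other vertices in
  -- neither.
  record LeafData (g : Fin n) : Set where
    field
      {p}    : Fin n
      {L P}  : Subset n
      g∈U    : g ∈ U
      p∈U    : p ∈ U
      g~p    : g ~ p
      p!     : ∀ {v} → v ∈ U → g ~ v → v ≡ p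
      crit   : Critical g p L P
      U⊆L∪P  : ∀ {v} → v ∈ U → v ∈ L ⊎ v ∈ P
      {ν μ}  : Fin n
      ν∈W    : ν ∈ W
      ν∈P    : ν ∈ P
      μ∈W    : μ ∈ W
      μ∈L    : μ ∈ L
      g~W    : ∀ {w} → w ∈ W → w ≢ ν → g ~ w
      ∣W∣≡1+k : # W ≡ suc k
    open Critical crit public

    notBoth : ∀ {ℓ} {A : Set ℓ} {v} → v ∈ L → v ∈ P → A
    notBoth v∈L v∈P = contradiction v∈P (disjoint v∈L)

  module _ {g p} (gleaf : Leaf U g) (p∈U : p ∈ U) (g~p : g ~ p) where
    private
      g∈U = Leaf.inside gleaf
      module _ {L P} (c : Critical g p L P) where
        open Critical c

        Σ WP WP̅ PU : Subset n
        Σ  = ∁ (L ∪ P)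
        WP = W ∩ P
        WP̅ = W ∩ ∁ P
        PU = P ∩ U

        p! : ∀ {v} → v ∈ U → g ~ v → v ≡ p
        p! v∈U g~v = ∣p∣≤1⇒≡ (Leaf.small gleaf) (∈∩⁺ v∈U (∈N⁺ g~v)) (∈∩⁺ p∈U (∈N⁺ g~p))

        N-g : ∀ {v} → v ∈ N g → v ≡ p ⊎ v ∈ N g ∩ WP̅
        N-g {v} v∈N with side v
        ... | inj₁ v∈U = inj₁ (p! v∈U (∈N⁻ v∈N))
        ... | inj₂ v∈W = inj₂ (∈∩⁺ v∈N (∈∩⁺ v∈W (∈∁⁺ λ v∈P →
          clash p∈U (subst (_∈ W) (proj₂ (only x∈ v∈P (∈N⁻ v∈N))) v∈W))))

        d≤ : d ≤ suc (# (N g ∩ WP̅))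
        d≤ = ≤-trans (degree≥d g∈U) (cover₁ p N-g)

        ∣NgWP̅∣≤ : # (N g ∩ WP̅) ≤ # WP̅
        ∣NgWP̅∣≤ = mono (proj₂ ∘ ∈∩⁻)

        ∣WP∣+∣WP̅∣ : # WP + # WP̅ ≤ # W
        ∣WP∣+∣WP̅∣ = pack (proj₁ ∘ ∈∩⁻) (proj₁ ∘ ∈∩⁻) λ v∈ v∈′ → ∈∁⁻ (proj₂ (∈∩⁻ v∈′)) (proj₂ (∈∩⁻ v∈))

        ∣WP∣≤1 : # WP ≤ 1
        ∣WP∣≤1 = linear (d ∷ # (N g ∩ WP̅) ∷ # WP ∷ # WP̅ ∷ # W ∷ [])
            (λ { (d ∷ a ∷ b ∷ c ∷ e ∷ []) →
                d ≼ con 1 ⊞ a ∷ a ≼ c ∷ b ⊞ c ≼ e ∷ e ≼ d ∷ []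
                ⊢ b ≼ con 1 })
            d≤ ∣NgWP̅∣≤ ∣WP∣+∣WP̅∣ ∣W∣≤d

        -- From `P` one reaches `L` only along `pg`, so a neighbour of `q` lies in `Σ`, in `W ∩ P`,
        -- in `P ∩ U`, or is `g`. `Σ′` may be smaller than `Σ` if `q` is known to miss a vertex
        -- there.
        count : ∀ {q} Σ′ R → q ∈ P → (∀ {v} → v ∈ Σ → q ~ v → v ∈ Σ′) →
                (∀ {v} → q ~ v → v ∈ PU → v ∈ R) → (q ≡ p → g ∈ R) → # (N q) ≤ # Σ′ + # WP + # R
        count {q} Σ′ R q∈P toΣ′ toR gR =
          ≤-trans (cover {q = Σ′ ∪ WP} λ v∈ → classify (∈N⁻ v∈)) (ℕ.+-monoˡ-≤ (# R) (cover ∈∪⁻))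
          where
          classify : ∀ {v} → q ~ v → v ∈ Σ′ ∪ WP ⊎ v ∈ R
          classify {v} q~v with v ∈? L | v ∈? P | side v
          ... | yes v∈L | _ | _ with only v∈L q∈P (~-sym q~v)
          ...   | refl , q≡p = inj₂ (gR q≡p)
          classify {v} q~v | no _ | yes v∈P | inj₁ v∈U = inj₂ (toR q~v (∈∩⁺ v∈P v∈U))
          classify {v} q~v | no _ | yes v∈P | inj₂ v∈W = inj₁ (∈∪⁺ (inj₂ (∈∩⁺ v∈W v∈P)))
          classify {v} q~v | no v∉L | no v∉P | _ =
            inj₁ (∈∪⁺ (inj₁ (toΣ′ (∈∁⁺ λ v∈ → [ v∉L , v∉P ]′ (∈∪⁻ v∈)) q~v)))

        -- A vertex of P ∩ U with at most one neighbour in U ∩ (P ∪ {g}).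
        record Tail (q : Fin n) : Set where
          field
            q∈PU : q ∈ PU
            R    : Subset n
            R≤1  : # R ≤ 1
            toR  : ∀ {v} → q ~ v → v ∈ PU → v ∈ R
            gR   : q ≡ p → g ∈ R
          q∈P = proj₁ (∈∩⁻ q∈PU)
          q∈U = proj₂ (∈∩⁻ q∈PU)

        leafTail : ∀ {q} → Leaf PU q → q ≢ p → Tail q
        leafTail {q} qleaf q≢p = record
          { q∈PU = Leaf.inside qleaf ; R = PU ∩ N q ; R≤1 = Leaf.small qleaf
          ; toR = λ q~v v∈ → ∈∩⁺ v∈ (∈N⁺ q~v) ; gR = λ q≡p → contradiction q≡p q≢p }

        p∈PU : p ∈ PU
        p∈PU = ∈∩⁺ y∈ p∈U

        -- A leaf of `P ∩ U` other than `p` has no neighbour in `L`. If `p` is alone in `P ∩ U`, its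
        -- one extra neighbour is `g`.
        tail : ∃ Tail
        tail with secondLeaf {PU} (proj₂ ∘ ∈∩⁻) p∈PU
        ... | inj₁ onlyp = p , record
          { q∈PU = p∈PU ; R = ⁅ g ⁆ ; R≤1 = ≤-reflexive ∣⁅x⁆∣≡1
          ; toR = λ p~v v∈ → contradiction p~v (~-irrefl (sym (onlyp v∈))) ; gR = λ _ → ∈⁅⁆⁺ refl }
        ... | inj₂ (q , qleaf , q≢p) = q , leafTail qleaf q≢p

        -- Used in both directions: with `# Σ < k < d` it forces a vertex of `W` into `P`, and with
        -- `# WP ≤ 1` it gives `d ≤ k + 1`.
        tailBound : d ≤ # Σ + # WP + 1
        tailBound = ≤-trans (degree≥d T.q∈U) (≤-trans (count Σ T.R T.q∈P (λ v∈ _ → v∈) T.toR T.gR) (ℕ.+-monoʳ-≤ _ T.R≤1))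
          where module T = Tail (proj₂ tail)

        1≤∣WP∣ : 1 ≤ # WP
        1≤∣WP∣ = linear (k ∷ d ∷ # Σ ∷ # WP ∷ [])
            (λ { (k ∷ d ∷ a ∷ b ∷ []) →
                con 1 ⊞ k ≼ d ∷ d ≼ a ⊞ b ⊞ con 1 ∷ con 1 ⊞ a ≼ k ∷ []
                ⊢ con 1 ≼ b })
            k<d tailBound ∣rest∣<k

        d≤1+k : d ≤ suc k
        d≤1+k = linear (d ∷ # WP ∷ # Σ ∷ k ∷ [])
            (λ { (d ∷ a ∷ b ∷ k ∷ []) →
                d ≼ b ⊞ a ⊞ con 1 ∷ a ≼ con 1 ∷ con 1 ⊞ b ≼ k ∷ []
                ⊢ d ≼ con 1 ⊞ k })
            tailBound ∣WP∣≤1 ∣rest∣<k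

        -- A tail missing a vertex of `Σ` would have at most `(k - 2) + 1 + 1` neighbours, fewer
        -- than `d`.
        tail~Σ : ∀ {q σ} → Tail q → σ ∈ Σ → q ~ σ
        tail~Σ {q} {σ} t σ∈ with q ~? σ
        ... | yes q~σ = q~σ
        ... | no q≁σ = absurd (linear (d ∷ # (N q) ∷ # T.R ∷ # WP ∷ # (Σ - σ) ∷ # Σ ∷ k ∷ [])
            (λ { (d ∷ a ∷ b ∷ c ∷ e ∷ f ∷ k ∷ []) →
                d ≼ a ∷ a ≼ e ⊞ c ⊞ b ∷ b ≼ con 1 ∷ c ≼ con 1 ∷ con 1 ⊞ e ≼ f ∷ con 1 ⊞ f ≼ k ∷ con 1 ⊞ k ≼ d ∷ []
                ⊢ con 1 ≼ con 0 })
            (degree≥d T.q∈U) bound T.R≤1 ∣WP∣≤1 (≤-reflexive (∣-∣ σ∈)) ∣rest∣<k k<d)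
          where
          module T = Tail t
          bound : # (N q) ≤ # (Σ - σ) + # WP + # T.R
          bound = count (Σ - σ) T.R T.q∈P (λ v∈ q~v → ∈-⁺ v∈ λ { refl → q≁σ q~v }) T.toR T.gR

        -- All tails are adjacent to `σ`, so `P ∩ U` together with `σ` is a path from `p` to `σ`. By
        -- `longPath`, `P` then has two vertices more than `P ∩ U`, but at most one vertex of `P` is
        -- in `W`.
        noΣ : ∀ {σ} → σ ∈ U → σ ∉ Σ
        noΣ {σ} σ∈U σ∈Σ = absurd (linear (# X ∷ # PU ∷ # P ∷ # WP ∷ [])
            (λ { (a ∷ b ∷ c ∷ e ∷ []) →
                con 1 ⊞ a ≼ c ∷ con 1 ⊞ b ≼ a ∷ c ≼ b ⊞ e ∷ e ≼ con 1 ∷ []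
                ⊢ con 1 ≼ con 0 })
            (longPath pathLike c g∉X) ∣X∣≥ ∣P∣≤ ∣WP∣≤1)
          where
          X : Subset n
          X = PU ∪ ⁅ σ ⁆

          PU⊆X : ∀ {v} → v ∈ PU → v ∈ X
          PU⊆X = ∈∪⁺ ∘ inj₁
          σ∈X : σ ∈ X
          σ∈X = ∈∪⁺ (inj₂ (∈⁅⁆⁺ refl))

          σ∉PU : σ ∉ PU
          σ∉PU σ∈ = ∈∁⁻ σ∈Σ (∈∪⁺ (inj₂ (proj₁ (∈∩⁻ σ∈))))

          inner : ∀ {v} → v ∈ X → v ≢ p → v ≢ σ → 2 ≤ # (X ∩ N v)
          inner {v} v∈X v≢p v≢σ with ∈∪⁻ v∈X
          ... | inj₂ v∈σ = contradiction (∈⁅⁆⁻ v∈σ) v≢σ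
          ... | inj₁ v∈PU with # (PU ∩ N v) ℕ.≤? 1
          ...   | no big = ≤-trans (ℕ.≰⇒> big) (mono λ w∈ → let (w∈PU , w∈N) = ∈∩⁻ w∈ in ∈∩⁺ (PU⊆X w∈PU) w∈N)
          ...   | yes small with 1≤∣p∣⁻ {p = PU ∩ N v} nonempty
            where
            v∈P = proj₁ (∈∩⁻ v∈PU)
            bound : # (N v) ≤ # Σ + # WP + # (PU ∩ N v)
            bound = count Σ (PU ∩ N v) v∈P (λ v∈ _ → v∈) (λ q~v v∈ → ∈∩⁺ v∈ (∈N⁺ q~v)) (λ v≡p → contradiction v≡p v≢p)
            deg : d ≤ # (N v)
            deg = degree≥d (proj₂ (∈∩⁻ v∈PU))
            nonempty : 1 ≤ # (PU ∩ N v)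
            nonempty = linear (k ∷ d ∷ # (N v) ∷ # WP ∷ # Σ ∷ # (PU ∩ N v) ∷ [])
                (λ { (k ∷ d ∷ a ∷ b ∷ c ∷ e ∷ []) →
                    con 1 ⊞ k ≼ d ∷ d ≼ a ∷ a ≼ c ⊞ b ⊞ e ∷ b ≼ con 1 ∷ con 1 ⊞ c ≼ k ∷ []
                    ⊢ con 1 ≼ e })
                k<d deg bound ∣WP∣≤1 ∣rest∣<k
          ...     | w , w∈ = 2≤∣p∣ (∈∩⁺ (PU⊆X w∈PU) w∈N) (∈∩⁺ σ∈X (∈N⁺ (tail~Σ (leafTail (leaf v∈PU small) v≢p) σ∈Σ)))
                               λ { refl → σ∉PU w∈PU }
            where
            w∈PU = proj₁ (∈∩⁻ w∈)
            w∈N  = proj₂ (∈∩⁻ w∈)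

          pathLike : PathLike X p σ
          pathLike = record
            { ⊆U    = λ v∈ → [ proj₂ ∘ ∈∩⁻ , (λ v∈σ → subst (_∈ U) (sym (∈⁅⁆⁻ v∈σ)) σ∈U) ]′ (∈∪⁻ v∈)
            ; first = PU⊆X p∈PU
            ; last  = σ∈X
            ; inner = inner
            ; end   = λ _ → 1≤∣p∣ (∈∩⁺ (PU⊆X (Tail.q∈PU (proj₂ tail))) (∈N⁺ (~-sym (tail~Σ (proj₂ tail) σ∈Σ))))
            }

          g∉X : g ∉ X
          g∉X g∈ with ∈∪⁻ g∈
          ... | inj₁ g∈PU = disjoint x∈ (proj₁ (∈∩⁻ g∈PU))
          ... | inj₂ g∈σ with ∈⁅⁆⁻ g∈σ
          ...   | refl = ∈∁⁻ σ∈Σ (∈∪⁺ (inj₁ x∈))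

          ∣X∣≥ : suc (# PU) ≤ # X
          ∣X∣≥ = insert≤ PU⊆X σ∈X σ∉PU

          ∣P∣≤ : # P ≤ # PU + # WP
          ∣P∣≤ = cover λ {v} v∈P → [ inj₁ ∘ ∈∩⁺ v∈P , (λ v∈W → inj₂ (∈∩⁺ v∈W v∈P)) ]′ (side v)

        U⊆L∪P : ∀ {v} → v ∈ U → v ∈ L ⊎ v ∈ P
        U⊆L∪P {v} v∈U with v ∈? L | v ∈? P
        ... | yes v∈L | _       = inj₁ v∈L
        ... | no _    | yes v∈P = inj₂ v∈P
        ... | no v∉L  | no v∉P  = contradiction (∈∁⁺ λ v∈ → [ v∉L , v∉P ]′ (∈∪⁻ v∈)) (noΣ v∈U)

        ∣W∣≥ : suc k ≤ # W
        ∣W∣≥ = linear (k ∷ d ∷ # (N g ∩ WP̅) ∷ # WP ∷ # WP̅ ∷ # W ∷ [])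
            (λ { (k ∷ d ∷ a ∷ b ∷ c ∷ e ∷ []) →
                con 1 ⊞ k ≼ d ∷ d ≼ con 1 ⊞ a ∷ a ≼ c ∷ b ⊞ c ≼ e ∷ con 1 ≼ b ∷ []
                ⊢ con 1 ⊞ k ≼ e })
            k<d d≤ ∣NgWP̅∣≤ ∣WP∣+∣WP̅∣ 1≤∣WP∣

        1≤∣WL∣ : 1 ≤ # (W ∩ L)
        1≤∣WL∣ = linear (k ∷ # W ∷ # (rest) ∷ # WP ∷ # Σ ∷ # (W ∩ L) ∷ [])
            (λ { (k ∷ a ∷ b ∷ c ∷ e ∷ f ∷ []) →
                con 1 ⊞ k ≼ a ∷ a ≼ c ⊞ b ∷ b ≼ e ⊞ f ∷ c ≼ con 1 ∷ con 1 ⊞ e ≼ k ∷ []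
                ⊢ con 1 ≼ f })
            ∣W∣≥ W≤₁ W≤₂ ∣WP∣≤1 ∣rest∣<k
          where
          rest : Subset n
          rest = Σ ∪ (W ∩ L)
          W≤₁ : # W ≤ # WP + # rest
          W≤₁ = cover λ {v} v∈W → case ((v ∈? P) , (v ∈? L)) of λ
            { (yes v∈P , _)        → inj₁ (∈∩⁺ v∈W v∈P)
            ; (no _    , yes v∈L)  → inj₂ (∈∪⁺ (inj₂ (∈∩⁺ v∈W v∈L)))
            ; (no v∉P  , no v∉L)   → inj₂ (∈∪⁺ (inj₁ (∈∁⁺ λ v∈ → [ v∉L , v∉P ]′ (∈∪⁻ v∈)))) }
          W≤₂ : # rest ≤ # Σ + # (W ∩ L)
          W≤₂ = cover ∈∪⁻

        g~WP̅ : ∀ {w} → w ∈ WP̅ → g ~ w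
        g~WP̅ w∈ = ∈N⁻ (proj₁ (∈∩⁻ (trapped (proj₂ ∘ ∈∩⁻) all w∈)))
          where
          all : # WP̅ ≤ # (N g ∩ WP̅)
          all = linear (# WP ∷ # WP̅ ∷ # W ∷ d ∷ # (N g ∩ WP̅) ∷ [])
              (λ { (a ∷ b ∷ c ∷ d ∷ e ∷ []) →
                  a ⊞ b ≼ c ∷ con 1 ≼ a ∷ c ≼ d ∷ d ≼ con 1 ⊞ e ∷ []
                  ⊢ b ≼ e })
              ∣WP∣+∣WP̅∣ 1≤∣WP∣ ∣W∣≤d d≤

        data′ : LeafData g
        data′ with 1≤∣p∣⁻ 1≤∣WP∣ | 1≤∣p∣⁻ 1≤∣WL∣
        ... | ν , ν∈ | μ , μ∈ = record
          { g∈U = g∈U ; p∈U = p∈U ; g~p = g~p ; p! = p! ; crit = c ; U⊆L∪P = U⊆L∪P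
          ; ν∈W = proj₁ (∈∩⁻ ν∈) ; ν∈P = proj₂ (∈∩⁻ ν∈) ; μ∈W = proj₁ (∈∩⁻ μ∈) ; μ∈L = proj₂ (∈∩⁻ μ∈)
          ; g~W = λ w∈W w≢ν → g~WP̅ (∈∩⁺ w∈W (∈∁⁺ λ w∈P → w≢ν (∣p∣≤1⇒≡ ∣WP∣≤1 (∈∩⁺ w∈W w∈P) ν∈)))
          ; ∣W∣≡1+k = ℕ.≤-antisym (≤-trans ∣W∣≤d d≤1+k) ∣W∣≥
          }

    leafData : LeafData g
    leafData with critical g∈U p∈U g~p
    ... | L , P , c = data′ c

  -- A union of components of `H[U]`, so that leaves of `Y` are leaves of `U`.
  record Closed (Y : Subset n) : Set where
    constructor closed
    field
      within : Y ⊆U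
      step   : ∀ {y v} → y ∈ Y → v ∈ U → y ~ v → v ∈ Y

  closedLeaf : ∀ {Y v} → Closed Y → Leaf Y v → Leaf U v
  closedLeaf (closed within step) (leaf v∈Y small) = leaf (within v∈Y) (≤-trans
    (mono λ w∈ → let (w∈U , w∈N) = ∈∩⁻ w∈ in ∈∩⁺ (step v∈Y w∈U (∈N⁻ w∈N)) w∈N) small)

  -- Inside `P`, only `p` has a neighbour in `L`. So a leaf of `Y ∩ P` other than `p` is a leaf of
  -- `U`, and if `p` is alone there, `g` is its only neighbour in `U`.
  farLeaf : ∀ {g Y} (D : LeafData g) → Closed Y → LeafData.p D ∈ Y → ∃ λ e → e ∈ Y × e ∈ LeafData.P D × Leaf U e
  farLeaf {g} {Y} D (closed within step) p∈Y with secondLeaf {Y ∩ D.P} (within ∘ proj₁ ∘ ∈∩⁻) (∈∩⁺ p∈Y D.y∈)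
    where module D = LeafData D
  ... | inj₁ onlyp = D.p , p∈Y , D.y∈ , leaf D.p∈U (∣p∣≤1 g λ v∈ → let (v∈U , v∈N) = ∈∩⁻ v∈ in nbr v∈U (∈N⁻ v∈N))
    where
    module D = LeafData D
    nbr : ∀ {v} → v ∈ U → D.p ~ v → v ≡ g
    nbr v∈U p~v with D.U⊆L∪P v∈U
    ... | inj₁ v∈L = proj₁ (D.only v∈L D.y∈ (~-sym p~v))
    ... | inj₂ v∈P = contradiction p~v (~-irrefl (sym (onlyp (∈∩⁺ (step p∈Y v∈U p~v) v∈P))))
  ... | inj₂ (e , leaf e∈ small , e≢p) = e , e∈Y , e∈P , leaf (within e∈Y) (≤-trans (mono nbr) small)
    where
    module D = LeafData D
    e∈Y = proj₁ (∈∩⁻ e∈)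
    e∈P = proj₂ (∈∩⁻ e∈)
    nbr : ∀ {v} → v ∈ U ∩ N e → v ∈ (Y ∩ D.P) ∩ N e
    nbr v∈ with ∈∩⁻ v∈
    ... | v∈U , v∈N with D.U⊆L∪P v∈U
    ...   | inj₁ v∈L = contradiction (proj₂ (D.only v∈L e∈P (~-sym (∈N⁻ v∈N)))) e≢p
    ...   | inj₂ v∈P = ∈∩⁺ (∈∩⁺ (step e∈Y v∈U (∈N⁻ v∈N)) v∈P) v∈N

  module _ {g} (D : LeafData g) where
    private
      module D = LeafData D

      covers : ∀ {i w} → i ∈ U → Empty (U ∩ N i) → w ∈ W → i ~ w
      covers {i} {w} i∈U isolated w∈W with i ~? w
      ... | yes i~w = i~w
      ... | no i≁w  = absurd (linear (# (N i) ∷ d ∷ # W ∷ [])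
          (λ { (a ∷ d ∷ b ∷ []) →
              con 1 ⊞ a ≼ b ∷ d ≼ a ∷ b ≼ d ∷ []
              ⊢ con 1 ≼ con 0 })
          few (degree≥d i∈U) ∣W∣≤d)
        where
        few : suc (# (N i)) ≤ # W
        few = insert≤ (λ {v} v∈N → [ (λ v∈U → contradiction (v , ∈∩⁺ v∈U v∈N) isolated) , (λ v∈W → v∈W) ]′ (side v))
          w∈W (i≁w ∘ ∈N⁻)

    -- An isolated vertex of `H[U]` needs all of `W` for its `d` neighbours, among them `μ` in `L`
    -- and `ν` in `P`; one of these edges crosses the separation and is not `gp`.
    nonisolated : ∀ {i} → i ∈ U → ∃ λ v → v ∈ U × i ~ v
    nonisolated {i} i∈U with nonempty? (U ∩ N i)
    ... | yes (v , v∈) = v , proj₁ (∈∩⁻ v∈) , ∈N⁻ (proj₂ (∈∩⁻ v∈))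
    ... | no isolated with D.U⊆L∪P i∈U
    ...   | inj₁ i∈L = clash (subst (_∈ U) (sym (proj₂ (D.only i∈L D.ν∈P (covers i∈U isolated D.ν∈W)))) D.p∈U) D.ν∈W
    ...   | inj₂ i∈P = clash (subst (_∈ U) (sym (proj₁ (D.only D.μ∈L i∈P (~-sym (covers i∈U isolated D.μ∈W))))) D.g∈U) D.μ∈W

    dataOf : ∀ {f} → Leaf U f → LeafData f
    dataOf fleaf with nonisolated (Leaf.inside fleaf)
    ... | p , p∈U , f~p = leafData fleaf p∈U f~p

  module _ {g f} (D : LeafData g) (E : LeafData f) where
    private
      module D = LeafData D
      module E = LeafData E

    -- The leaf `f` sees all of `W` except `E.ν`. An edge from `f` to `D.μ` would be a second edge
    -- across the separation of `D`, so `D.μ` is the exception; `near` is the same with `D.ν`.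
    far : f ∈ D.P → E.ν ≡ D.μ
    far f∈P with E.ν Fin.≟ D.μ
    ... | yes eq = eq
    ... | no neq = clash (subst (_∈ U) (sym (proj₁ (D.only D.μ∈L f∈P (~-sym (E.g~W D.μ∈W (neq ∘ sym)))))) D.g∈U) D.μ∈W

    near : f ∈ D.L → f ≢ g → E.ν ≡ D.ν
    near f∈L f≢g with E.ν Fin.≟ D.ν
    ... | yes eq = eq
    ... | no neq = contradiction (proj₁ (D.only f∈L D.ν∈P (E.g~W D.ν∈W (neq ∘ sym)))) f≢g

  -- The only edge from `L` to `P` leaves from `g`, and the only neighbour of `g` in `U` is in `P`.
  nearClosed : ∀ {g} (D : LeafData g) → Closed ((LeafData.L D ∩ U) - g)
  nearClosed {g} D = closed (proj₂ ∘ ∈∩⁻ ∘ proj₁ ∘ ∈-⁻) step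
    where
    module D = LeafData D
    step : ∀ {y v} → y ∈ (D.L ∩ U) - g → v ∈ U → y ~ v → v ∈ (D.L ∩ U) - g
    step y∈ v∈U y~v with ∈-⁻ y∈ | D.U⊆L∪P v∈U
    ... | y∈′ , y≢g | inj₂ v∈P = contradiction (proj₁ (D.only (proj₁ (∈∩⁻ y∈′)) v∈P y~v)) y≢g
    ... | y∈′ , y≢g | inj₁ v∈L = ∈-⁺ (∈∩⁺ v∈L v∈U) λ
      { refl → D.notBoth (proj₁ (∈∩⁻ y∈′)) (subst (_∈ D.P) (sym (D.p! (proj₂ (∈∩⁻ y∈′)) (~-sym y~v))) D.y∈) }

  -- If one leaf is on the far side of the other, `far` separates the two vertices. Otherwise the
  -- component of `g` lies on the near side of `E` and contains a third leaf `e`, far for `D` and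
  -- near for `E`; its missed vertex would be both `D.μ` and `E.ν`.
  ν-injective : ∀ {g f} (D : LeafData g) (E : LeafData f) → f ≢ g → LeafData.ν D ≢ LeafData.ν E
  ν-injective {g} {f} D E f≢g ν≡ with D.U⊆L∪P E.g∈U | E.U⊆L∪P D.g∈U
    where
    module D = LeafData D
    module E = LeafData E
  ... | inj₂ f∈P | _ = D.notBoth (subst (_∈ D.L) (sym (trans ν≡ (far D E f∈P))) D.μ∈L) D.ν∈P
    where module D = LeafData D
  ... | inj₁ _ | inj₂ g∈P = E.notBoth (subst (_∈ E.L) (sym (trans (sym ν≡) (far E D g∈P))) E.μ∈L) E.ν∈P
    where module E = LeafData E
  ... | inj₁ f∈L | inj₁ g∈L
    with farLeaf D (nearClosed E) (Closed.step (nearClosed E) (∈-⁺ (∈∩⁺ g∈L (LeafData.g∈U D)) (f≢g ∘ sym)) (LeafData.p∈U D) (LeafData.g~p D))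
  ...   | e , e∈Y , e∈P , eleaf with ∈-⁻ e∈Y
  ...     | e∈′ , e≢f = D.notBoth (subst (_∈ D.L) (sym (trans ν≡ (trans (sym (near E F (proj₁ (∈∩⁻ e∈′)) e≢f)) (far D F e∈P)))) D.μ∈L) D.ν∈P
    where
    module D = LeafData D
    F : LeafData e
    F = dataOf D eleaf

  -- Any further vertices would contain another leaf of `U`, which by `near` misses the same vertex
  -- as `g`.
  near-trivial : ∀ {g} (D : LeafData g) {v} → v ∈ LeafData.L D → v ∈ U → v ≡ g
  near-trivial {g} D {v} v∈L v∈U with v Fin.≟ g
  ... | yes v≡g = v≡g
  ... | no v≢g with forest {(LeafData.L D ∩ U) - g} (Closed.within (nearClosed D)) (v , ∈-⁺ (∈∩⁺ v∈L v∈U) v≢g)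
  ...   | f , fleaf with ∈-⁻ (Leaf.inside fleaf)
  ...     | f∈ , f≢g = contradiction (sym (near D F (proj₁ (∈∩⁻ f∈)) f≢g)) (ν-injective D F f≢g)
    where
    F : LeafData f
    F = dataOf D (closedLeaf (nearClosed D) fleaf)

  μ-neighbours : ∀ {g v} (D : LeafData g) → LeafData.μ D ~ v → v ≡ g ⊎ (v ∈ W × v ≢ LeafData.ν D × v ≢ LeafData.μ D)
  μ-neighbours {g} {v} D μ~v with v ∈? D.P | side v
    where module D = LeafData D
  ... | yes v∈P | _ = clash (subst (_∈ U) (sym (proj₁ (D.only D.μ∈L v∈P μ~v))) D.g∈U) D.μ∈W
    where module D = LeafData D
  ... | no v∉P | inj₂ v∈W = inj₂ (v∈W , (λ { refl → v∉P (LeafData.ν∈P D) }) , λ { refl → ~-irrefl refl μ~v })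
  ... | no v∉P | inj₁ v∈U with LeafData.U⊆L∪P D v∈U
  ...   | inj₁ v∈L = inj₁ (near-trivial D v∈L v∈U)
  ...   | inj₂ v∈P = contradiction v∈P v∉P

  -- H - Z is the path μ, l, …, e, ν, and Z is joined completely to it.
  record Shape : Set where
    field
      {l e ν μ} : Fin n
      l∈U      : l ∈ U
      e∈U      : e ∈ U
      l≢e      : l ≢ e
      ν∈W      : ν ∈ W
      μ∈W      : μ ∈ W
      ν≢μ      : ν ≢ μ
    Z : Subset n
    Z = (W - ν) - μ
    field
      ∣Z∣      : suc (# Z) ≡ k
      U-path   : Path U l e
      ν-nbr    : ∀ {v} → ν ~ v → v ≡ e ⊎ v ∈ Z
      μ-nbr    : ∀ {v} → μ ~ v → v ≡ l ⊎ v ∈ Z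
      ν~e      : ν ~ e
      μ~l      : μ ~ l
      Z-complete : ∀ {z v} → z ∈ Z → v ∉ Z → v ~ z

  module _ {l e} (D : LeafData l) (E : LeafData e) (e∈P : e ∈ LeafData.P D) where
    private
      module D = LeafData D
      module E = LeafData E

      e≢l : e ≢ l
      e≢l refl = D.notBoth D.x∈ e∈P

      νE≡μD : E.ν ≡ D.μ
      νE≡μD = far D E e∈P

      νD≡μE : D.ν ≡ E.μ
      νD≡μE with E.U⊆L∪P D.g∈U
      ... | inj₁ l∈L = contradiction (near E D l∈L (e≢l ∘ sym)) (ν-injective D E e≢l)
      ... | inj₂ l∈P = far E D l∈P

      -- By `near` and `far`, a third leaf would miss `D.ν` or `D.μ`, which `l` and `e` already
      -- miss.
      noOther : ∀ {f} → Leaf U f → f ≢ l → f ≢ e → ∀ {A : Set} → A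
      noOther {f} fleaf f≢l f≢e with D.U⊆L∪P (Leaf.inside fleaf)
      ... | inj₁ f∈L = contradiction (sym (near D F f∈L f≢l)) (ν-injective D F f≢l)
        where F = dataOf D fleaf
      ... | inj₂ f∈P = contradiction (trans νE≡μD (sym (far D F f∈P))) (ν-injective E F f≢e)
        where F = dataOf D fleaf

      Z : Subset n
      Z = (W - D.ν) - D.μ

      ∈Z : ∀ {v} → v ∈ W → v ≢ D.ν → v ≢ D.μ → v ∈ Z
      ∈Z v∈W v≢ν v≢μ = ∈-⁺ (∈-⁺ v∈W v≢ν) v≢μ

      ν≢μ : D.ν ≢ D.μ
      ν≢μ eq = D.notBoth (subst (_∈ D.L) (sym eq) D.μ∈L) D.ν∈P

      ∣Z∣ : suc (# Z) ≡ k
      ∣Z∣ = ℕ.suc-injective (trans (cong suc (∣-∣ (∈-⁺ D.μ∈W (ν≢μ ∘ sym)))) (trans (∣-∣ D.ν∈W) D.∣W∣≡1+k))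

      μ-nbr : ∀ {v} → D.μ ~ v → v ≡ l ⊎ v ∈ Z
      μ-nbr μ~v with μ-neighbours D μ~v
      ... | inj₁ v≡l                 = inj₁ v≡l
      ... | inj₂ (v∈W , v≢ν , v≢μ) = inj₂ (∈Z v∈W v≢ν v≢μ)

      ν-nbr : ∀ {v} → D.ν ~ v → v ≡ e ⊎ v ∈ Z
      ν-nbr ν~v with μ-neighbours E (subst (_~ _) νD≡μE ν~v)
      ... | inj₁ v≡e                 = inj₁ v≡e
      ... | inj₂ (v∈W , v≢ν , v≢μ) = inj₂ (∈Z v∈W (v≢μ ∘ λ eq → trans eq νD≡μE) (v≢ν ∘ λ eq → trans eq (sym νE≡μD)))

      -- The set `⁅ x ⁆ ∪ Z` has at most `k` vertices, so `w`, of degree at least `k`, is adjacent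
      -- to all of them.
      saturated : ∀ {w x} → (∀ {v} → w ~ v → v ≡ x ⊎ v ∈ Z) → ∀ {v} → v ≡ x ⊎ v ∈ Z → w ~ v
      saturated {w} {x} nbr {v} v∈ = ∈N⁻ (trapped {q = ⁅ x ⁆ ∪ Z}
        (λ u∈ → ∈∪⁺ ([ inj₁ ∘ ∈⁅⁆⁺ , inj₂ ]′ (nbr (∈N⁻ u∈)))) enough (∈∪⁺ ([ inj₁ ∘ ∈⁅⁆⁺ , inj₂ ]′ v∈)))
        where
        size : # (⁅ x ⁆ ∪ Z) ≤ suc (# Z)
        size = cover₁ x λ u∈ → [ inj₁ ∘ ∈⁅⁆⁻ , inj₂ ]′ (∈∪⁻ u∈)
        enough : # (⁅ x ⁆ ∪ Z) ≤ # (N w)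
        enough = linear (# (⁅ x ⁆ ∪ Z) ∷ # Z ∷ k ∷ # (N w) ∷ [])
            (λ { (a ∷ b ∷ k ∷ c ∷ []) →
                a ≼ con 1 ⊞ b ∷ con 1 ⊞ b ≼ k ∷ k ≼ c ∷ []
                ⊢ a ≼ c })
            size (≤-reflexive ∣Z∣) (degree≥k w)

      inner : ∀ {v} → v ∈ U → v ≢ l → v ≢ e → 2 ≤ # (U ∩ N v)
      inner {v} v∈U v≢l v≢e with # (U ∩ N v) ℕ.≤? 1
      ... | no big    = ℕ.≰⇒> big
      ... | yes small = noOther (leaf v∈U small) v≢l v≢e

      U-path : Path U l e
      U-path = pathLike⇒path record
        { ⊆U = λ v∈ → v∈ ; first = D.g∈U ; last = E.g∈U ; inner = inner
        ; end = λ _ → 1≤∣p∣ (∈∩⁺ E.p∈U (∈N⁺ E.g~p)) }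

      degreeU≤2 : ∀ {v} → v ∈ U → v ≢ l → # (U ∩ N v) ≤ 2
      degreeU≤2 {v} v∈U v≢l with Path.exhaustive U-path v∈U
      ... | zero  , _  , eq   = contradiction (trans (sym eq) (Path.first U-path)) v≢l
      ... | suc i , i< , refl = ≤-trans (cover₁ (at i) (split (at i)))
        (s≤s (∣p∣≤1 (at (suc (suc i))) λ w∈ → let (w∈′ , w≢) = ∈-⁻ w∈ ; (w∈U , w∈N) = ∈∩⁻ w∈′ in
          [ (λ e → contradiction e w≢) , (λ e → e) ]′ (nbr w∈U (∈N⁻ w∈N))))
        where
        open Path U-path
        nbr : ∀ {w} → w ∈ U → at (suc i) ~ w → w ≡ at i ⊎ w ≡ at (suc (suc i))
        nbr w∈U v~w with exhaustive w∈U
        ... | j , j< , refl with ℕ.<-cmp (suc i) j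
        ...   | tri< i<j _ _   = inj₂ (cong at (steps i<j j< v~w))
        ...   | tri≈ _ refl _  = contradiction v~w (~-irrefl refl)
        ...   | tri> _ _ j<i   = inj₁ (cong at (ℕ.suc-injective (sym (steps j<i i< (~-sym v~w)))))

      -- At most two of the at least `k + 1` neighbours are on the path and neither `ν` nor `μ` is
      -- one, so the `k - 1` vertices of `Z` are all needed.
      inner~Z : ∀ {z v} → z ∈ Z → v ∈ U → v ≢ l → v ≢ e → v ~ z
      inner~Z {z} {v} z∈Z v∈U v≢l v≢e = ∈N⁻ (proj₁ (∈∩⁻ (trapped (proj₂ ∘ ∈∩⁻) all z∈Z)))
        where
        classify : ∀ {w} → w ∈ N v → w ∈ U ∩ N v ⊎ w ∈ N v ∩ Z
        classify {w} w∈N with side w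
        ... | inj₁ w∈U = inj₁ (∈∩⁺ w∈U w∈N)
        ... | inj₂ w∈W = inj₂ (∈∩⁺ w∈N (∈Z w∈W
          (λ { refl → [ v≢e , clash v∈U ∘ proj₁ ∘ ∈-⁻ ∘ proj₁ ∘ ∈-⁻ ]′ (ν-nbr (~-sym (∈N⁻ w∈N))) })
          (λ { refl → [ v≢l , clash v∈U ∘ proj₁ ∘ ∈-⁻ ∘ proj₁ ∘ ∈-⁻ ]′ (μ-nbr (~-sym (∈N⁻ w∈N))) })))
        bound : # (N v) ≤ # (U ∩ N v) + # (N v ∩ Z)
        bound = cover classify
        all : # Z ≤ # (N v ∩ Z)
        all = linear (k ∷ d ∷ # (N v) ∷ # (U ∩ N v) ∷ # Z ∷ # (N v ∩ Z) ∷ [])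
            (λ { (k ∷ d ∷ a ∷ b ∷ c ∷ e ∷ []) →
                con 1 ⊞ k ≼ d ∷ d ≼ a ∷ a ≼ b ⊞ e ∷ b ≼ con 2 ∷ con 1 ⊞ c ≼ k ∷ []
                ⊢ c ≼ e })
            k<d (degree≥d v∈U) bound (degreeU≤2 v∈U v≢l) (≤-reflexive ∣Z∣)

      Z-complete : ∀ {z v} → z ∈ Z → v ∉ Z → v ~ z
      Z-complete {z} {v} z∈Z v∉Z with side v | ∈-⁻ z∈Z
      ... | inj₁ v∈U | z∈′ , z≢μ with v Fin.≟ l | v Fin.≟ e | ∈-⁻ z∈′
      ...   | yes refl | _        | z∈W , z≢ν = D.g~W z∈W z≢ν
      ...   | no _     | yes refl | z∈W , z≢ν = E.g~W z∈W λ eq → z≢μ (trans eq νE≡μD)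
      ...   | no v≢l   | no v≢e   | _          = inner~Z z∈Z v∈U v≢l v≢e
      Z-complete {z} {v} z∈Z v∉Z | inj₂ v∈W | _ with v Fin.≟ D.ν | v Fin.≟ D.μ
      ...   | yes refl | _        = saturated ν-nbr (inj₂ z∈Z)
      ...   | no _     | yes refl = saturated μ-nbr (inj₂ z∈Z)
      ...   | no v≢ν   | no v≢μ   = contradiction (∈Z v∈W v≢ν v≢μ) v∉Z

    shapeOf : Shape
    shapeOf = record
      { l∈U = D.g∈U ; e∈U = E.g∈U ; l≢e = e≢l ∘ sym ; ν∈W = D.ν∈W ; μ∈W = D.μ∈W ; ν≢μ = ν≢μ
      ; ∣Z∣ = ∣Z∣ ; U-path = U-path ; ν-nbr = ν-nbr ; μ-nbr = μ-nbr
      ; ν~e = saturated ν-nbr (inj₁ refl) ; μ~l = saturated μ-nbr (inj₁ refl) ; Z-complete = Z-complete }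

  shape : ∀ {x y} → x ∈ U → y ∈ U → x ~ y → Shape
  shape x∈U y∈U x~y with edgeLeaf (λ v∈ → v∈) x∈U y∈U x~y
  ... | g , gleaf , p , p∈U , g~p with leafData gleaf p∈U g~p
  ...   | D with farLeaf D (closed (λ v∈ → v∈) (λ _ v∈ _ → v∈)) (LeafData.p∈U D)
  ...     | e , _ , e∈P , eleaf = shapeOf D (dataOf D eleaf) e∈P

-- Vertex deletion versus separations

∈-irrelevant : ∀ {n} {p : Subset n} {v} (a b : v ∈ p) → a ≡ b
∈-irrelevant Vec.here      Vec.here      = refl
∈-irrelevant (Vec.there a) (Vec.there b) = cong Vec.there (∈-irrelevant a b)

module _ {n : ℕ} (k : ℕ) (G : Graph (Fin n)) where
  open Graph G
  open Separations k G

  -- Were the sides too large, fewer than `k` vertices would lie outside `A ∪ B`, and after their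
  -- deletion no walk could leave `A`.
  cutBound : KConnected k G → CutBound
  cutBound (k<n , connected) {A} {B} (a , a∈A) (b , b∈B) disj noEdge with # A + # B + k ℕ.≤? n
  ... | yes h = h
  ... | no ¬h = contradiction b∈B (disj (stays (connected S S<k (a , outside (inj₁ a∈A)) (b , outside (inj₂ b∈B))) a∈A))
    where
    S : Subset n
    S = ∁ (A ∪ B)

    ∣A∪B∣≥ : # A + # B ≤ # (A ∪ B)
    ∣A∪B∣≥ = pack (∈∪⁺ ∘ inj₁) (∈∪⁺ ∘ inj₂) disj

    S<k : suc (Subset.∣ S ∣) ≤ k
    S<k = subst (λ m → suc m ≤ k) #-def (bound (≤-reflexive (∣p∣+∣∁p∣≡n {p = A ∪ B})))
      where
      bound : # (A ∪ B) + # S ≤ n → suc (# S) ≤ k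
      bound h = linear (# (A ∪ B) ∷ # (∁ (A ∪ B)) ∷ # A ∷ # B ∷ n ∷ k ∷ [])
          (λ { (a ∷ b ∷ c ∷ e ∷ n ∷ k ∷ []) →
              a ⊞ b ≼ n ∷ c ⊞ e ≼ a ∷ con 1 ⊞ n ≼ c ⊞ e ⊞ k ∷ []
              ⊢ con 1 ⊞ b ≼ k })
          h ∣A∪B∣≥ (ℕ.≰⇒> ¬h)

    outside : ∀ {v} → v ∈ A ⊎ v ∈ B → v ∈ Subset.∁ S
    outside v∈ = Subset.x∉p⇒x∈∁p λ v∈S → ∈∁⁻ v∈S (∈∪⁺ v∈)

    stays : ∀ {u v} → Star (Graph._~_ (deleteVertices G S)) u v → proj₁ u ∈ A → proj₁ v ∈ A
    stays ε u∈A = u∈A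
    stays (_◅_ {j = w , w∉S} u~w rest) u∈A with w ∈? (A ∪ B)
    ... | no w∉ = contradiction (∈∁⁺ w∉) (Subset.x∈∁p⇒x∉p w∉S)
    ... | yes w∈ with ∈∪⁻ w∈
    ...   | inj₁ w∈A = stays rest w∈A
    ...   | inj₂ w∈B = contradiction u~w (noEdge u∈A w∈B)

  kConnected : k < n → CutBound → KConnected k G
  kConnected k<n kc = k<n , λ S S<k → connected S (subst (_< k) (sym #-def) S<k)
    where
    connected : ∀ S → # S < k → Connected (deleteVertices G S)
    connected S S<k u (v , v∈∁S) = grow n (ℕ.m≤m+n n _) (∈⁅⁆⁺ refl)
      λ a∈ → subst (λ a → ∃ λ p → Reach (a , p)) (sym (∈⁅⁆⁻ a∈)) (proj₂ u , ε)
      where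
      Reach : (∃ λ a → a ∈ Subset.∁ S) → Set
      Reach = Star (Graph._~_ (deleteVertices G S)) u

      -- The set A of the vertices found so far grows until it contains v.
      grow : ∀ m {A} → n ≤ m + # A → proj₁ u ∈ A → (∀ {a} → a ∈ A → ∃ λ p → Reach (a , p)) → Reach (v , v∈∁S)
      grow m {A} h u∈A reach with v ∈? A
      ... | yes v∈A with reach v∈A
      ...   | p , walk = subst (λ p → Reach (v , p)) (∈-irrelevant p v∈∁S) walk
      grow m {A} h u∈A reach | no v∉A with Fin.any? (λ a → (a ∈? A) ×-dec Fin.any? (λ b → ¬? (b ∈? A) ×-dec (b ∈? Subset.∁ S) ×-dec (a ~? b)))
      -- No edge joins `A` to the set `B` of the vertices outside `A ∪ S`, yet fewer than `k`
      -- vertices lie outside these two sides.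
      ... | no stuck = absurd (linear (# A ∷ # B ∷ k ∷ # (∁ A) ∷ n ∷ # S ∷ [])
          (λ { (a ∷ b ∷ k ∷ c ∷ n ∷ e ∷ []) →
              a ⊞ b ⊞ k ≼ n ∷ c ≼ b ⊞ e ∷ n ≼ a ⊞ c ∷ con 1 ⊞ e ≼ k ∷ []
              ⊢ con 1 ≼ con 0 })
          (kc (_ , u∈A) (v , ∈∁⁺ v∉A∪S) disj noEdge) rest
          (≤-reflexive (sym (∣p∣+∣∁p∣≡n {p = A}))) S<k)
        where
        B : Subset n
        B = ∁ (A ∪ S)
        v∉A∪S : v ∉ A ∪ S
        v∉A∪S v∈ = [ v∉A , Subset.x∈∁p⇒x∉p v∈∁S ]′ (∈∪⁻ v∈)
        disj : ∀ {w} → w ∈ A → w ∉ B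
        disj w∈A w∈B = ∈∁⁻ w∈B (∈∪⁺ (inj₁ w∈A))
        noEdge : ∀ {a b} → a ∈ A → b ∈ B → ¬ a ~ b
        noEdge {a} {b} a∈A b∈B a~b = stuck (a , a∈A , b , (λ b∈A → disj b∈A b∈B) ,
          Subset.x∉p⇒x∈∁p (λ b∈S → ∈∁⁻ b∈B (∈∪⁺ (inj₂ b∈S))) , a~b)
        rest : # (∁ A) ≤ # B + # S
        rest = cover λ {w} w∉A → case w ∈? S of λ
          { (yes w∈S) → inj₂ w∈S
          ; (no w∉S)  → inj₁ (∈∁⁺ λ w∈ → [ ∈∁⁻ w∉A , w∉S ]′ (∈∪⁻ w∈)) }
      grow m {A} h u∈A reach | no v∉A | yes (a , a∈A , b , b∉A , b∈∁S , a~b) = continue m h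
        where
        bigger : suc (# A) ≤ # (A ∪ ⁅ b ⁆)
        bigger = insert≤ (∈∪⁺ ∘ inj₁) (∈∪⁺ (inj₂ (∈⁅⁆⁺ refl))) b∉A

        reach′ : ∀ {w} → w ∈ A ∪ ⁅ b ⁆ → ∃ λ p → Reach (w , p)
        reach′ w∈ with ∈∪⁻ w∈
        ... | inj₁ w∈A = reach w∈A
        ... | inj₂ w∈b with ∈⁅⁆⁻ w∈b
        ...   | refl = b∈∁S , proj₂ (reach a∈A) ◅◅ (a~b ◅ ε)

        continue : ∀ m → n ≤ m + # A → Reach (v , v∈∁S)
        continue zero    h = absurd (linear (n ∷ # A ∷ # (∁ A) ∷ [])
            (λ { (n ∷ a ∷ b ∷ []) →
                n ≼ a ∷ a ⊞ b ≼ n ∷ con 1 ≼ b ∷ []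
                ⊢ con 1 ≼ con 0 })
            h (≤-reflexive (∣p∣+∣∁p∣≡n {p = A})) (1≤∣p∣ (∈∁⁺ b∉A)))
        continue (suc m) h = grow m {A ∪ ⁅ b ⁆} (linear (n ∷ # A ∷ m ∷ # (A ∪ ⁅ b ⁆) ∷ [])
            (λ { (n ∷ a ∷ m ∷ b ∷ []) →
                n ≼ con 1 ⊞ m ⊞ a ∷ con 1 ⊞ a ≼ b ∷ []
                ⊢ n ≼ m ⊞ b })
            h bigger) (∈∪⁺ (inj₁ u∈A)) reach′

-- Exchanging edges at a completely joined set

-- H′ arises from H by the deletion of ux and vy and the insertion of xy.
module Exchange {n k : ℕ} (H H′ : Graph (Fin n)) (kc : Separations.CutBound k H)
  (degree≥k : ∀ v → k ≤ # (Separations.N k H′ v))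
  (Z : Subset n) (Z-complete : ∀ {z v} → z ∈ Z → v ∉ Z → Graph._~_ H v z)
  {x y u v : Fin n} (u≢v : u ≢ v) (x~y : Graph._~_ H′ x y)
  (kept : ∀ {a b} → a ∈ Z → b ∉ Z → Graph._~_ H a b → Graph._~_ H′ a b ⊎ (a ≡ x × b ≡ u ⊎ a ≡ y × b ≡ v))
  (keptInside : ∀ {a b} → (a ∈ Z × b ∈ Z) ⊎ (a ∉ Z × b ∉ Z) → Graph._~_ H a b → Graph._~_ H′ a b)
  where
  open Graph H
  private
    module H′ = Graph H′
    module S′ = Separations k H′

    Lost : Fin n → Fin n → Set
    Lost a b = a ≡ x × b ≡ u ⊎ a ≡ y × b ≡ v

    x≢y : x ≢ y
    x≢y x≡y = H′.~-irrefl x≡y x~y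

    Lost-injective : ∀ {a a′ b} → Lost a b → Lost a′ b → a ≡ a′
    Lost-injective (inj₁ (refl , _))    (inj₁ (refl , _)) = refl
    Lost-injective (inj₁ (_ , refl))    (inj₂ (_ , eq))   = contradiction eq u≢v
    Lost-injective (inj₂ (_ , refl))    (inj₁ (_ , eq))   = contradiction (sym eq) u≢v
    Lost-injective (inj₂ (refl , _))    (inj₂ (refl , _)) = refl

    Lost-functional : ∀ {a b b′} → Lost a b → Lost a b′ → b ≡ b′
    Lost-functional (inj₁ (_ , refl))   (inj₁ (_ , refl)) = refl
    Lost-functional (inj₁ (refl , _))   (inj₂ (eq , _))   = contradiction eq x≢y
    Lost-functional (inj₂ (refl , _))   (inj₁ (eq , _))   = contradiction (sym eq) x≢y
    Lost-functional (inj₂ (_ , refl))   (inj₂ (_ , refl)) = refl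

    Lost-adjacent : ∀ {a a′ b b′} → Lost a b → Lost a′ b′ → a ≢ a′ → a H′.~ a′
    Lost-adjacent (inj₁ (refl , _)) (inj₁ (refl , _)) a≢a′ = contradiction refl a≢a′
    Lost-adjacent (inj₁ (refl , _)) (inj₂ (refl , _)) a≢a′ = x~y
    Lost-adjacent (inj₂ (refl , _)) (inj₁ (refl , _)) a≢a′ = H′.~-sym x~y
    Lost-adjacent (inj₂ (refl , _)) (inj₂ (refl , _)) a≢a′ = contradiction refl a≢a′

    module _ {A B : Subset n} (disj : ∀ {w} → w ∈ A → w ∉ B) (noEdge : ∀ {a b} → a ∈ A → b ∈ B → ¬ a H′.~ b)
             (big : n < # A + # B + k) where

      lost : ∀ {z w} → z ∈ A → z ∈ Z → w ∈ B → w ∉ Z → Lost z w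
      lost z∈A z∈Z w∈B w∉Z with kept z∈Z w∉Z (~-sym (Z-complete z∈Z w∉Z))
      ... | inj₁ z~w = contradiction z~w (noEdge z∈A w∈B)
      ... | inj₂ l   = l

      -- The neighbours of a vertex alone in `A` all lie outside `A ∪ B`, and there are at least `k`
      -- of them.
      two : ∀ {a} → a ∈ A → 2 ≤ # A
      two {a} a∈A with 2 ℕ.≤? # A
      ... | yes h = h
      ... | no ¬h = absurd (linear (k ∷ # B ∷ # (S′.N a) ∷ n ∷ # A ∷ # (∁ A) ∷ [])
          (λ { (k ∷ a ∷ b ∷ n ∷ c ∷ e ∷ []) →
              k ≼ b ∷ a ⊞ b ≼ e ∷ con 1 ⊞ n ≼ c ⊞ a ⊞ k ∷ c ⊞ e ≼ n ∷ []
              ⊢ con 1 ≼ con 0 })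
          (degree≥k a) apart big (≤-reflexive (∣p∣+∣∁p∣≡n {p = A})))
        where
        apart : # B + # (S′.N a) ≤ # (∁ A)
        apart = pack (λ w∈B → ∈∁⁺ λ w∈A → disj w∈A w∈B)
          (λ w∈N → ∈∁⁺ λ w∈A → H′.~-irrefl (∣p∣≤1⇒≡ (ℕ.≤-pred (ℕ.≰⇒> ¬h)) a∈A w∈A) (S′.∈N⁻ w∈N))
          (λ w∈B w∈N → noEdge a∈A w∈B (S′.∈N⁻ w∈N))

    module _ {A B : Subset n} (disj : ∀ {w} → w ∈ A → w ∉ B) (noEdge : ∀ {a b} → a ∈ A → b ∈ B → ¬ a H′.~ b)
             (big : n < # A + # B + k) where
      private
        disj′ : ∀ {w} → w ∈ B → w ∉ A
        disj′ w∈B w∈A = disj w∈A w∈B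
        noEdge′ : ∀ {a b} → a ∈ B → b ∈ A → ¬ a H′.~ b
        noEdge′ a∈B b∈A a~b = noEdge b∈A a∈B (H′.~-sym a~b)
        big′ : n < # B + # A + k
        big′ = linear (n ∷ # A ∷ # B ∷ k ∷ [])
            (λ { (n ∷ a ∷ b ∷ k ∷ []) →
                con 1 ⊞ n ≼ a ⊞ b ⊞ k ∷ []
                ⊢ con 1 ⊞ n ≼ b ⊞ a ⊞ k })
            big

      -- By `two` there are further vertices `a` in `A` and `b` in `B`. If `a` is in `Z` or `b` is
      -- not, a second lost edge meets `w` or `z`, but the lost edges `xu` and `yv` are disjoint.
      -- Otherwise `zw` and `ba` are both lost, and `z` and `b` are the ends of the present edge
      -- `xy`.
      noLost : ∀ {z w} → z ∈ A → z ∈ Z → w ∈ B → w ∉ Z → ∀ {C : Set} → C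
      noLost {z} {w} z∈A z∈Z w∈B w∉Z with another (two disj noEdge big z∈A) z | another (two disj′ noEdge′ big′ w∈B) w
      ... | a , a∈A , a≢z | b , b∈B , b≢w with a ∈? Z | b ∈? Z
      ...   | yes a∈Z | _ = contradiction (Lost-injective (lost disj noEdge big a∈A a∈Z w∈B w∉Z) (lost disj noEdge big z∈A z∈Z w∈B w∉Z)) a≢z
      ...   | no _ | no b∉Z = contradiction (Lost-functional (lost disj noEdge big z∈A z∈Z b∈B b∉Z) (lost disj noEdge big z∈A z∈Z w∈B w∉Z)) b≢w
      ...   | no a∉Z | yes b∈Z = contradiction
              (Lost-adjacent (lost disj noEdge big z∈A z∈Z w∈B w∉Z) (lost disj′ noEdge′ big′ b∈B b∈Z a∈A a∉Z) λ { refl → disj z∈A b∈B })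
              (noEdge z∈A b∈B)

  exchange : Separations.CutBound k H′
  exchange {A} {B} A≢∅ B≢∅ disj noEdge with # A + # B + k ℕ.≤? n
  ... | yes h = h
  ... | no ¬h = kc A≢∅ B≢∅ disj noEdgeH
    where
    big : n < # A + # B + k
    big = ℕ.≰⇒> ¬h
    noEdgeH : ∀ {a b} → a ∈ A → b ∈ B → ¬ a ~ b
    noEdgeH {a} {b} a∈A b∈B a~b with a ∈? Z | b ∈? Z
    ... | yes a∈Z | yes b∈Z = noEdge a∈A b∈B (keptInside (inj₁ (a∈Z , b∈Z)) a~b)
    ... | no a∉Z  | no b∉Z  = noEdge a∈A b∈B (keptInside (inj₂ (a∉Z , b∉Z)) a~b)
    ... | yes a∈Z | no b∉Z  = noLost disj noEdge big a∈A a∈Z b∈B b∉Z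
    ... | no a∉Z  | yes b∈Z = noLost (λ w∈B w∈A → disj w∈A w∈B) (λ b∈ a∈ b~a → noEdge a∈ b∈ (H′.~-sym b~a)) (linear (n ∷ # A ∷ # B ∷ k ∷ [])
        (λ { (n ∷ a ∷ b ∷ k ∷ []) →
            con 1 ⊞ n ≼ a ⊞ b ⊞ k ∷ []
            ⊢ con 1 ⊞ n ≼ b ⊞ a ⊞ k })
        big) b∈B b∈Z a∈A a∉Z

-- Matchings as edge lists and their enlargement

AllPairs-resp-↭ : {A : Set} {R : A → A → Set} → Symmetric R → ∀ {xs ys} → xs ↭ ys → AllPairs R xs → AllPairs R ys
AllPairs-resp-↭ sy Perm.refl         rs                         = rs
AllPairs-resp-↭ sy (Perm.prep x p)   (r ∷ rs)                   = All-resp-↭ p r ∷ AllPairs-resp-↭ sy p rs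
AllPairs-resp-↭ sy (Perm.swap x y p) ((xy ∷ xs) ∷ (ys ∷ rs))    =
  (sy xy ∷ All-resp-↭ p ys) ∷ (All-resp-↭ p xs ∷ AllPairs-resp-↭ sy p rs)
AllPairs-resp-↭ sy (Perm.trans p q)  rs                         = AllPairs-resp-↭ sy q (AllPairs-resp-↭ sy p rs)

extract : {A : Set} {P : A → Set} {xs : List A} → Any P xs → ∃₂ λ x ys → P x × xs ↭ x ∷ ys
extract (here {x} {xs} px) = x , xs , px , Perm.refl
extract (there {a} i) with extract i
... | x , ys , px , p = x , a ∷ ys , px , Perm.trans (Perm.prep a p) (Perm.swap a x Perm.refl)

-- Search through all pairs of vertex sets; this makes the case distinction of `enlarge`
-- constructive.
critical? : ∀ {n} k (H : Graph (Fin n)) x y → Dec (∃₂ (Separations.Critical k H x y))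
critical? {n} k H x y = anySubset? λ A → anySubset? λ B → map′
  (λ { (x∈ , y∈ , disj , only , large) → record
    { x∈ = x∈ ; y∈ = y∈ ; disjoint = λ {v} → disj v ; only = λ {a} {b} a∈ b∈ → only a a∈ b b∈ ; large = large } })
  (λ c → let open Critical c in x∈ , y∈ , (λ v → disjoint) , (λ a a∈ b b∈ → only a∈ b∈) , large)
  ((x ∈? A) ×-dec (y ∈? B) ×-dec Fin.all? (λ v → (v ∈? A) →-dec ¬? (v ∈? B))
    ×-dec Fin.all? (λ a → (a ∈? A) →-dec Fin.all? (λ b → (b ∈? B) →-dec ((a ~? b) →-dec ((a Fin.≟ x) ×-dec (b Fin.≟ y)))))
    ×-dec (suc n ℕ.≤? # A + # B + k))
  where
  open Graph H
  open Separations k H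

module _ {n : ℕ} (G : Graph (Fin n)) where
  open Graph G

  Deleted : List (Edge G) → Fin n → Fin n → Set
  Deleted es u v = Any (λ e → Joins {G = G} e u v) es

  joins? : ∀ (e : Edge G) u v → Dec (Joins {G = G} e u v)
  joins? (x , y , _) u v = ((x Fin.≟ u) ×-dec (y Fin.≟ v)) ⊎-dec ((x Fin.≟ v) ×-dec (y Fin.≟ u))

  deleted? : ∀ es u v → Dec (Deleted es u v)
  deleted? es u v = any? (λ e → joins? e u v) es

  deleted-sym : ∀ {es u v} → Deleted es u v → Deleted es v u
  deleted-sym = Any.map Sum.swap

  Meets : Fin n → Edge G → Set
  Meets v (x , y , _) = x ≡ v ⊎ y ≡ v

  Covered : List (Edge G) → Fin n → Set
  Covered es v = Any (Meets v) es

  covered? : ∀ es v → Dec (Covered es v)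
  covered? es v = any? (λ { (x , y , _) → (x Fin.≟ v) ⊎-dec (y Fin.≟ v) }) es

  deleted⇒covered : ∀ {es u v} → Deleted es u v → Covered es v
  deleted⇒covered = Any.map λ { (inj₁ (_ , y≡v)) → inj₂ y≡v ; (inj₂ (x≡v , _)) → inj₁ x≡v }

  opaque

    uncovered : List (Edge G) → Subset n
    uncovered es = comprehension (λ v → ¬? (covered? es v))

    ∈uncovered⁺ : ∀ {es v} → ¬ Covered es v → v ∈ uncovered es
    ∈uncovered⁺ {es} = ∈-comprehension⁺ (λ v → ¬? (covered? es v))

    ∈uncovered⁻ : ∀ {es v} → v ∈ uncovered es → ¬ Covered es v
    ∈uncovered⁻ {es} = ∈-comprehension⁻ (λ v → ¬? (covered? es v))

  ∈∁uncovered⁻ : ∀ {es v} → v ∈ ∁ (uncovered es) → Covered es v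
  ∈∁uncovered⁻ {es} {v} v∈ = decidable-stable (covered? es v) (∈∁⁻ v∈ ∘ ∈uncovered⁺)

  ∈∁uncovered⁺ : ∀ {es v} → Covered es v → v ∈ ∁ (uncovered es)
  ∈∁uncovered⁺ c = ∈∁⁺ λ v∈ → ∈uncovered⁻ v∈ c

  ∣covered∣≤ : ∀ es → # (∁ (uncovered es)) ≤ length es + length es
  ∣covered∣≤ [] = ≤-reflexive (∣p∣≡0 λ { (_ , v∈) → case ∈∁uncovered⁻ {[]} v∈ of λ () })
  ∣covered∣≤ ((x , y , xy) ∷ es) = linear (# (∁ (uncovered ((x , y , xy) ∷ es))) ∷ # (⁅ y ⁆ ∪ ∁ (uncovered es)) ∷ # (∁ (uncovered es)) ∷ length es ∷ [])
      (λ { (a ∷ b ∷ c ∷ e ∷ []) →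
          a ≼ con 1 ⊞ b ∷ b ≼ con 1 ⊞ c ∷ c ≼ e ⊞ e ∷ []
          ⊢ a ≼ con 1 ⊞ e ⊞ (con 1 ⊞ e) })
      (cover₁ {p = ∁ (uncovered ((x , y , xy) ∷ es))} x first) rest (∣covered∣≤ es)
    where
    first : ∀ {v} → v ∈ ∁ (uncovered ((x , y , xy) ∷ es)) → v ≡ x ⊎ v ∈ ⁅ y ⁆ ∪ ∁ (uncovered es)
    first v∈ with ∈∁uncovered⁻ v∈
    ... | here (inj₁ x≡v) = inj₁ (sym x≡v)
    ... | here (inj₂ y≡v) = inj₂ (∈∪⁺ (inj₁ (∈⁅⁆⁺ (sym y≡v))))
    ... | there c         = inj₂ (∈∪⁺ (inj₂ (∈∁uncovered⁺ c)))
    rest : # (⁅ y ⁆ ∪ ∁ (uncovered es)) ≤ suc (# (∁ (uncovered es)))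
    rest = cover₁ y λ v∈ → [ inj₁ ∘ ∈⁅⁆⁻ , inj₂ ]′ (∈∪⁻ v∈)

  Disjoint : Edge G → Edge G → Set
  Disjoint = VertexDisjoint {G = G}

  disjoint-sym : Symmetric Disjoint
  disjoint-sym (u≢x , u≢y , v≢x , v≢y) = u≢x ∘ sym , v≢x ∘ sym , u≢y ∘ sym , v≢y ∘ sym

  unmet : ∀ {x y xy e} → ¬ Meets x e → ¬ Meets y e → Disjoint (x , y , xy) e
  unmet ¬x ¬y = (λ eq → ¬x (inj₁ (sym eq))) , (λ eq → ¬x (inj₂ (sym eq))) , (λ eq → ¬y (inj₁ (sym eq))) , (λ eq → ¬y (inj₂ (sym eq)))

  joins-disjoint : ∀ e e′ {u a b} → Joins {G = G} e u a → Joins {G = G} e′ u b → ¬ Disjoint e e′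
  joins-disjoint e e′ (inj₁ (refl , _)) (inj₁ (refl , _)) (d , _)         = d refl
  joins-disjoint e e′ (inj₁ (refl , _)) (inj₂ (_ , refl)) (_ , d , _)     = d refl
  joins-disjoint e e′ (inj₂ (_ , refl)) (inj₁ (refl , _)) (_ , _ , d , _) = d refl
  joins-disjoint e e′ (inj₂ (_ , refl)) (inj₂ (_ , refl)) (_ , _ , _ , d) = d refl

  partner-unique : ∀ {es u a b} → AllPairs Disjoint es → Deleted es u a → Deleted es u b → a ≡ b
  partner-unique {e ∷ _} _ (here p) (here q) = joins-unique e p q
    where
    joins-unique : ∀ e {u a b} → Joins {G = G} e u a → Joins {G = G} e u b → a ≡ b
    joins-unique e             (inj₁ (refl , refl)) (inj₁ (_ , refl))    = refl
    joins-unique (_ , _ , xy) (inj₁ (refl , refl)) (inj₂ (refl , refl)) = refl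
    joins-unique (_ , _ , xy) (inj₂ (refl , refl)) (inj₁ (refl , refl)) = refl
    joins-unique e             (inj₂ (refl , refl)) (inj₂ (refl , _))    = refl
  partner-unique {e ∷ _} (d ∷ _) (here p) (there q) with All.lookupAny d q
  ... | d′ , q′ = contradiction d′ (joins-disjoint e (Any.lookup q) p q′)
  partner-unique {e ∷ _} (d ∷ _) (there p) (here q) with All.lookupAny d p
  ... | d′ , p′ = contradiction d′ (joins-disjoint e (Any.lookup p) q p′)
  partner-unique (_ ∷ ds) (there p) (there q) = partner-unique ds p q

  module _ (k : ℕ) where
    private
      N : Fin n → Subset n
      N = Separations.N k G
      N∖ : List (Edge G) → Fin n → Subset n
      N∖ es = Separations.N k (deleteEdges G es)

    kept : ∀ {es u v} → v ∈ N u → ¬ Deleted es u v → v ∈ N∖ es u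
    kept {es} v∈ ¬d = Separations.∈N⁺ k (deleteEdges G es) (Separations.∈N⁻ k G v∈ , ¬d)

    degree-deleted : ∀ {es} → AllPairs Disjoint es → ∀ u → # (N u) ≤ suc (# (N∖ es u))
    degree-deleted {es} ds u with Fin.any? (deleted? es u)
    ... | no none      = ℕ.m≤n⇒m≤1+n (mono λ {v} v∈ → kept v∈ λ d → none (v , d))
    ... | yes (w , dw) = cover₁ w λ {v} v∈ → case deleted? es u v of λ
      { (yes d) → inj₁ (partner-unique ds d dw) ; (no ¬d) → inj₂ (kept v∈ ¬d) }

    degree-uncovered : ∀ {es u} → u ∈ uncovered es → # (N u) ≤ # (N∖ es u)
    degree-uncovered u∈ = mono λ v∈ → kept v∈ λ d → ∈uncovered⁻ u∈ (deleted⇒covered (deleted-sym d))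

    Good : List (Edge G) → Set
    Good es = AllPairs Disjoint es × Separations.CutBound k (deleteEdges G es)

    -- A separation violating the bound after the deletion of `uv` must have `uv` as its only edge
    -- across in `H`, so it witnesses criticality, with its sides exchanged if `v` is in `A`.
    augment : ∀ {es u v} → Good es → u ∈ uncovered es → v ∈ uncovered es → (uv : Graph._~_ (deleteEdges G es) u v) →
              ¬ ∃₂ (Separations.Critical k (deleteEdges G es) u v) → Good ((u , v , proj₁ uv) ∷ es)
    augment {es} {u} {v} (ds , kc) u∈ v∈ uv ¬c =
      (All.zipWith (λ { {f} (¬u , ¬v) → unmet {xy = proj₁ uv} {e = f} ¬u ¬v }) (¬Any⇒All¬ es (∈uncovered⁻ u∈) , ¬Any⇒All¬ es (∈uncovered⁻ v∈)) ∷ ds) , kc′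
      where
      H = deleteEdges G es
      module H = Graph H
      e : Edge G
      e = u , v , proj₁ uv

      kc′ : Separations.CutBound k (deleteEdges G (e ∷ es))
      kc′ {A} {B} A≢∅ B≢∅ disj noEdge with # A + # B + k ℕ.≤? n
      ... | yes h = h
      ... | no ¬h = kc A≢∅ B≢∅ disj none
        where
        big : suc n ≤ # A + # B + k
        big = ℕ.≰⇒> ¬h
        joined : ∀ {a b} → a ∈ A → b ∈ B → a H.~ b → Joins {G = G} e a b
        joined {a} {b} a∈ b∈ (a~b , ¬d) = decidable-stable (joins? e a b) λ ¬j →
          noEdge a∈ b∈ (a~b , λ { (here j) → ¬j j ; (there d) → ¬d d })
        none : ∀ {a b} → a ∈ A → b ∈ B → ¬ a H.~ b
        none a∈ b∈ a~b with joined a∈ b∈ a~b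
        ... | inj₁ (refl , refl) = ¬c (A , B , record
          { x∈ = a∈ ; y∈ = b∈ ; disjoint = disj ; large = big
          ; only = λ a′∈ b′∈ a′~b′ → case joined a′∈ b′∈ a′~b′ of λ
            { (inj₁ (e₁ , e₂))   → sym e₁ , sym e₂
            ; (inj₂ (refl , _)) → contradiction b′∈ (disj a∈) } })
        ... | inj₂ (refl , refl) = ¬c (B , A , record
          { x∈ = b∈ ; y∈ = a∈ ; disjoint = λ v∈B v∈A → disj v∈A v∈B ; large = linear (n ∷ # A ∷ # B ∷ k ∷ [])
              (λ { (n ∷ a ∷ b ∷ k ∷ []) →
                  con 1 ⊞ n ≼ a ⊞ b ⊞ k ∷ []
                  ⊢ con 1 ⊞ n ≼ b ⊞ a ⊞ k })
              big
          ; only = λ b′∈ a′∈ b′~a′ → case joined a′∈ b′∈ (H.~-sym b′~a′) of λ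
            { (inj₂ (e₁ , e₂))   → sym e₁ , sym e₂
            ; (inj₁ (refl , _)) → contradiction b∈ (disj a′∈) } })

    -- The permutation brings `xy` to the front, where it is replaced by `ux` and `vy`. These exist
    -- since `Z` is joined to `u` and `v`. Degree `k` survives because the new list is again a
    -- matching.
    swapEdge : ∀ {es es′ x y xy u v Z} → (∀ w → suc k ≤ # (N w)) → Good es → es ↭ (x , y , xy) ∷ es′ →
      x ∈ Z → y ∈ Z → u ∉ Z → v ∉ Z → u ≢ v → u ∈ uncovered es → v ∈ uncovered es →
      (∀ {z w} → z ∈ Z → w ∉ Z → Graph._~_ (deleteEdges G es) w z) →
      ∃ λ fs → length fs ≡ suc (length es) × Good fs
    swapEdge {es} {es′} {x} {y} {xy} {u} {v} {Z} deg (ds , kc) perm x∈Z y∈Z u∉Z v∉Z u≢v u∈ v∈ Z-complete =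
      fs , cong suc (sym (↭-length perm)) , dfs , exchange
      where
      ux = proj₁ (Z-complete x∈Z u∉Z)
      vy = proj₁ (Z-complete y∈Z v∉Z)
      fs : List (Edge G)
      fs = (u , x , ux) ∷ (v , y , vy) ∷ es′

      ds′ : AllPairs Disjoint ((x , y , xy) ∷ es′)
      ds′ = AllPairs-resp-↭ (λ {e} {f} → disjoint-sym {e} {f}) perm ds

      apart = AllPairs.head ds′
      ds″ = AllPairs.tail ds′

      unmet′ : ∀ {w} → w ∈ uncovered es → All (λ e → ¬ Meets w e) es′
      unmet′ w∈ = ¬Any⇒All¬ es′ λ c → ∈uncovered⁻ w∈ (Any-resp-↭ (↭-sym perm) (there c))

      ∈≢∉ : ∀ {a b} → a ∉ Z → b ∈ Z → a ≢ b
      ∈≢∉ a∉ b∈ refl = a∉ b∈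

      dfs : AllPairs Disjoint fs
      dfs = ((u≢v , ∈≢∉ u∉Z y∈Z , ∈≢∉ v∉Z x∈Z ∘ sym , λ x≡y → ~-irrefl x≡y xy)
              ∷ All.zipWith (λ { (¬u , (x≢a , x≢b , _)) → (λ e → ¬u (inj₁ (sym e))) , (λ e → ¬u (inj₂ (sym e))) , x≢a , x≢b }) (unmet′ u∈ , apart))
            ∷ (All.zipWith (λ { (¬v , (_ , _ , y≢a , y≢b)) → (λ e → ¬v (inj₁ (sym e))) , (λ e → ¬v (inj₂ (sym e))) , y≢a , y≢b }) (unmet′ v∈ , apart))
            ∷ ds″

      old : ∀ {a b} → Deleted es′ a b → Deleted es a b
      old d = Any-resp-↭ (↭-sym perm) (there d)

      degree≥k : ∀ w → k ≤ # (N∖ fs w)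
      degree≥k w = ℕ.≤-pred (≤-trans (deg w) (degree-deleted dfs w))

      x~y : Graph._~_ (deleteEdges G fs) x y
      x~y = xy , λ
        { (here (inj₁ (e , _)))         → ∈≢∉ u∉Z x∈Z e
        ; (here (inj₂ (e , _)))         → ∈≢∉ u∉Z y∈Z e
        ; (there (here (inj₁ (e , _)))) → ∈≢∉ v∉Z x∈Z e
        ; (there (here (inj₂ (e , _)))) → ∈≢∉ v∉Z y∈Z e
        ; (there (there d)) → let (d₁ , d₂) = All.lookupAny apart d in
            joins-disjoint (x , y , xy) (Any.lookup d) (inj₁ (refl , refl)) d₂ d₁ }

      across : ∀ {a b} → a ∈ Z → b ∉ Z → Graph._~_ (deleteEdges G es) a b →
               Graph._~_ (deleteEdges G fs) a b ⊎ (a ≡ x × b ≡ u ⊎ a ≡ y × b ≡ v)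
      across {a} {b} a∈Z b∉Z (a~b , ¬d) with deleted? fs a b
      ... | no ¬d′                                 = inj₁ (a~b , ¬d′)
      ... | yes (here (inj₁ (e , _)))              = contradiction e (∈≢∉ u∉Z a∈Z)
      ... | yes (here (inj₂ (e , e′)))             = inj₂ (inj₁ (sym e′ , sym e))
      ... | yes (there (here (inj₁ (e , _))))      = contradiction e (∈≢∉ v∉Z a∈Z)
      ... | yes (there (here (inj₂ (e , e′))))     = inj₂ (inj₂ (sym e′ , sym e))
      ... | yes (there (there d))                  = contradiction (old d) ¬d

      within : ∀ {a b} → (a ∈ Z × b ∈ Z) ⊎ (a ∉ Z × b ∉ Z) → Graph._~_ (deleteEdges G es) a b →
               Graph._~_ (deleteEdges G fs) a b
      within (inj₁ (a∈Z , b∈Z)) (a~b , ¬d) = a~b , λ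
        { (here (inj₁ (e , _)))         → ∈≢∉ u∉Z a∈Z e
        ; (here (inj₂ (e , _)))         → ∈≢∉ u∉Z b∈Z e
        ; (there (here (inj₁ (e , _)))) → ∈≢∉ v∉Z a∈Z e
        ; (there (here (inj₂ (e , _)))) → ∈≢∉ v∉Z b∈Z e
        ; (there (there d))             → ¬d (old d) }
      within (inj₂ (a∉Z , b∉Z)) (a~b , ¬d) = a~b , λ
        { (here (inj₁ (_ , e)))         → ∈≢∉ b∉Z x∈Z (sym e)
        ; (here (inj₂ (_ , e)))         → ∈≢∉ a∉Z x∈Z (sym e)
        ; (there (here (inj₁ (_ , e)))) → ∈≢∉ b∉Z y∈Z (sym e)
        ; (there (here (inj₂ (_ , e)))) → ∈≢∉ a∉Z y∈Z (sym e)
        ; (there (there d))             → ¬d (old d) }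

      open Exchange {k = k} (deleteEdges G es) (deleteEdges G fs) kc degree≥k Z Z-complete u≢v x~y across within

-- Recognising cycles and complete graphs

module CycleGraph {n m : ℕ} (G : Graph (Fin n)) (at : ℕ → Fin n)
  (surjective : ∀ v → ∃ λ i → i < 3 + m × at i ≡ v)
  (injective : ∀ {i j} → i < j → j < 3 + m → at i ≢ at j)
  (step : ∀ {i} → suc i < 3 + m → Graph._~_ G (at i) (at (suc i)))
  (close : Graph._~_ G (at (2 + m)) (at 0))
  (steps : ∀ {i j} → i < j → j < 3 + m → Graph._~_ G (at i) (at j) → suc i ≡ j ⊎ (suc j ≡ 3 + m × i ≡ 0))
  where
  open Graph G
  private

    to : Fin n → Fin (3 + m)
    to v = fromℕ< (proj₁ (proj₂ (surjective v)))

    from : Fin (3 + m) → Fin n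
    from i = at (toℕ i)

    from-to : ∀ v → from (to v) ≡ v
    from-to v = let (i , i< , eq) = surjective v in trans (cong at (Fin.toℕ-fromℕ< i<)) eq

    from-injective : ∀ {i j} → from i ≡ from j → i ≡ j
    from-injective {i} {j} eq with ℕ.<-cmp (toℕ i) (toℕ j)
    ... | tri< i<j _ _ = contradiction eq (injective i<j (Fin.toℕ<n j))
    ... | tri≈ _ i≡j _ = Fin.toℕ-injective i≡j
    ... | tri> _ _ j<i = contradiction (sym eq) (injective j<i (Fin.toℕ<n i))

    next⇒~ : ∀ i j → Next i j → from i ~ from j
    next⇒~ i j (inj₁ eq) = subst (λ t → from i ~ at t) eq (step (subst (_< 3 + m) (sym eq) (Fin.toℕ<n j)))
    next⇒~ i j (inj₂ (eq , j≡0)) rewrite j≡0 | ℕ.suc-injective eq = close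

    ~⇒next : ∀ i j → from i ~ from j → Next i j ⊎ Next j i
    ~⇒next i j i~j with ℕ.<-cmp (toℕ i) (toℕ j)
    ... | tri< i<j _ _ = [ inj₁ ∘ inj₁ , inj₂ ∘ inj₂ ]′ (steps i<j (Fin.toℕ<n j) i~j)
    ... | tri≈ _ i≡j _ = contradiction i~j (~-irrefl (cong at i≡j))
    ... | tri> _ _ j<i = [ inj₂ ∘ inj₁ , inj₁ ∘ inj₂ ]′ (steps j<i (Fin.toℕ<n i) (~-sym i~j))

  isCycle : IsCycle G
  isCycle = m , mk↔ₛ′ to from (λ i → from-injective (from-to (from i))) from-to , λ u v → mk⇔
    (λ u~v → ~⇒next (to u) (to v) (subst (_~ from (to v)) (sym (from-to u)) (subst (u ~_) (sym (from-to v)) u~v)))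
    (λ adj → subst (_~ v) (from-to u) (subst (from (to u) ~_) (from-to v)
      ([ next⇒~ (to u) (to v) , ~-sym ∘ next⇒~ (to v) (to u) ]′ adj)))

isComplete : ∀ {n} m (G : Graph (Fin n)) → n ≡ m → (∀ u v → u ≢ v → Graph._~_ G u v) → G ≅ complete m
isComplete m G refl adj = mk↔ₛ′ (λ v → v) (λ v → v) (λ _ → refl) (λ _ → refl) , λ u v →
  mk⇔ (λ u~v u≡v → Graph.~-irrefl G u≡v u~v) (adj u v)

-- One enlargement step

module Enlarge {n : ℕ} (G : Graph (Fin n)) (k d : ℕ) (k<n : k < n) (k<d : suc k ≤ d)
  (degree≥d : ∀ v → d ≤ # (Separations.N k G v))
  {es : List (Edge G)} (good : Good G k es) (2∣es∣≤d : length es + length es ≤ d)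
  where
  open Graph G

  private
    Enlargement : Set
    Enlargement = ∃ λ fs → length fs ≡ suc (length es) × Good G k fs

    ds = proj₁ good
    kc = proj₂ good

    H : Graph (Fin n)
    H = deleteEdges G es
    module H = Graph H

    U W : Subset n
    U = uncovered G es
    W = ∁ U

    degree≥1+k : ∀ v → suc k ≤ # (Separations.N k G v)
    degree≥1+k v = ≤-trans k<d (degree≥d v)

    ∣W∣≤2∣es∣ : # W ≤ length es + length es
    ∣W∣≤2∣es∣ = ∣covered∣≤ G es

    ∣W∣≤d : # W ≤ d
    ∣W∣≤d = ≤-trans ∣W∣≤2∣es∣ 2∣es∣≤d

    degreeU≥d : ∀ {u} → u ∈ U → d ≤ # (Separations.N k H u)
    degreeU≥d u∈U = ≤-trans (degree≥d _) (degree-uncovered G k u∈U)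

    deleted-∈W : ∀ {u v} → Deleted G es u v → v ∈ W
    deleted-∈W d = ∈∁uncovered⁺ G (deleted⇒covered G d)

    module AllCritical (critical : ∀ {u v} → u ∈ U → v ∈ U → u H.~ v → ∃₂ (Separations.Critical k H u v)) where
      open Structure k d k<d H kc U ∣W∣≤d degreeU≥d
        (λ v → ℕ.≤-pred (≤-trans (degree≥1+k v) (degree-deleted G k ds v))) critical
        public hiding (W)

      module Shaped (S : Shape) where
        open Shape S

        ∈Z : ∀ {v} → v ∈ W → v ≢ ν → v ≢ μ → v ∈ Z
        ∈Z v∈W v≢ν v≢μ = ∈-⁺ (∈-⁺ v∈W v≢ν) v≢μ

        ν∉Z : ν ∉ Z
        ν∉Z ν∈ = proj₂ (∈-⁻ (proj₁ (∈-⁻ ν∈))) refl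

        Z⊆W : ∀ {v} → v ∈ Z → v ∈ W
        Z⊆W = proj₁ ∘ ∈-⁻ ∘ proj₁ ∘ ∈-⁻

        -- The degree of ν in H is only k.
        lostNeighbour : ∃ λ v → v ∈ Separations.N k G ν × v ∉ N ν
        lostNeighbour with Fin.any? (λ v → (v ∈? Separations.N k G ν) ×-dec ¬? (v ∈? N ν))
        ... | yes found = found
        ... | no none   = absurd (linear (k ∷ # (Separations.N k G ν) ∷ # (N ν) ∷ # Z ∷ [])
            (λ { (k ∷ a ∷ b ∷ c ∷ []) →
                con 1 ⊞ k ≼ a ∷ a ≼ b ∷ b ≼ con 1 ⊞ c ∷ con 1 ⊞ c ≼ k ∷ []
                ⊢ con 1 ≼ con 0 })
            (degree≥1+k ν) same small (≤-reflexive ∣Z∣))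
          where
          same : # (Separations.N k G ν) ≤ # (N ν)
          same = mono λ {v} v∈ → decidable-stable (v ∈? N ν) λ v∉ → none (v , v∈ , v∉)
          small : # (N ν) ≤ suc (# Z)
          small = cover₁ e λ v∈ → ν-nbr (∈N⁻ v∈)

        -- The other end of the deleted edge at `ν` is covered, but not in `Z`, since `ν` is still
        -- adjacent to all of `Z` in `H`; only `μ` is left.
        deletedνμ : Deleted G es ν μ
        deletedνμ with lostNeighbour
        ... | v , v∈G , v∉H = subst (Deleted G es ν) v≡μ deleted
          where
          ν~v : ν ~ v
          ν~v = Separations.∈N⁻ k G v∈G
          deleted : Deleted G es ν v
          deleted = decidable-stable (deleted? G es ν v) λ ¬d → v∉H (∈N⁺ (ν~v , ¬d))
          v≡μ : v ≡ μ
          v≡μ = decidable-stable (v Fin.≟ μ) λ v≢μ →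
            v∉H (∈N⁺ (Z-complete (∈Z (deleted-∈W deleted) (λ { refl → ~-irrefl refl ν~v }) v≢μ) ν∉Z))

        -- As `ν` and `μ` are matched to each other, matching edges at `Z` stay inside `Z`, which is
        -- what `swapEdge` needs.
        partner-∈Z : ∀ {z w} → z ∈ Z → Deleted G es z w → w ∈ Z
        partner-∈Z {z} {w} z∈Z d = ∈Z (deleted-∈W d)
          (λ { refl → proj₂ (∈-⁻ z∈Z) (partner-unique G ds (deleted-sym G d) deletedνμ) })
          (λ { refl → proj₂ (∈-⁻ (proj₁ (∈-⁻ z∈Z))) (partner-unique G ds (deleted-sym G d) (deleted-sym G deletedνμ)) })

        U∩Z : ∀ {v} → v ∈ U → v ∉ Z
        U∩Z v∈U v∈Z = clash v∈U (Z⊆W v∈Z)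

        swapInZ : ∀ {z} → z ∈ Z → Enlargement
        swapInZ {z} z∈Z with extract (∈∁uncovered⁻ G (Z⊆W z∈Z))
        ... | (x , y , xy) , es′ , meets , perm = swapEdge G k degree≥1+k good perm (proj₁ (both meets)) (proj₂ (both meets))
                (U∩Z l∈U) (U∩Z e∈U) l≢e l∈U e∈U Z-complete
          where
          both : Meets G z (x , y , xy) → x ∈ Z × y ∈ Z
          both (inj₁ refl) = z∈Z , partner-∈Z z∈Z (Any-resp-↭ (↭-sym perm) (here (inj₁ (refl , refl))))
          both (inj₂ refl) = partner-∈Z z∈Z (Any-resp-↭ (↭-sym perm) (here (inj₂ (refl , refl)))) , z∈Z

        module _ (Z-empty : Empty Z) where
          module P = Path U-path

          h : ℕ → Fin n
          h 0             = ν
          h 1             = μ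
          h (suc (suc i)) = P.at i

          size : ∃ λ m → # U ≡ suc m
          size with # U | 1≤∣p∣ l∈U
          ... | suc m | _ = m , refl

          m : ℕ
          m = proj₁ size
          ∣U∣ : # U ≡ suc m
          ∣U∣ = proj₂ size

          below : ∀ {i} → 2 + i < 3 + m → i < # U
          below (s≤s (s≤s i<)) = subst (_ <_) (sym ∣U∣) i<

          U-edge : ∀ {u v} → v ∈ U → u ~ v → u H.~ v
          U-edge v∈U u~v = u~v , λ d → clash v∈U (deleted-∈W d)

          last-at : P.at m ≡ e
          last-at = P.last (sym ∣U∣)

          nbr : ∀ {v} {x : Fin n} → v ≡ x ⊎ v ∈ Z → v ≡ x
          nbr = [ (λ eq → eq) , (λ v∈Z → contradiction (_ , v∈Z) Z-empty) ]′

          surjective : ∀ v → ∃ λ i → i < 3 + m × h i ≡ v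
          surjective v with side v
          ... | inj₁ v∈U = let (i , i< , eq) = P.exhaustive v∈U in 2 + i , s≤s (s≤s (subst (i <_) ∣U∣ i<)) , eq
          ... | inj₂ v∈W with v Fin.≟ ν | v Fin.≟ μ
          ...   | yes refl | _        = 0 , s≤s z≤n , refl
          ...   | no _     | yes refl = 1 , s≤s (s≤s z≤n) , refl
          ...   | no v≢ν   | no v≢μ   = contradiction (v , ∈Z v∈W v≢ν v≢μ) Z-empty

          injective : ∀ {i j} → i < j → j < 3 + m → h i ≢ h j
          injective {0}           {1}           _ _ eq = ν≢μ eq
          injective {0}           {suc (suc j)} _ j< eq = clash (subst (_∈ U) (sym eq) (P.inside (below j<))) ν∈W
          injective {1}           {1}           (s≤s ()) _ _
          injective {1}           {suc (suc j)} _ j< eq = clash (subst (_∈ U) (sym eq) (P.inside (below j<))) μ∈W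
          injective {suc (suc i)} {suc (suc j)} (s≤s (s≤s i<j)) j< eq = P.injective i<j (below j<) eq
          injective {suc (suc i)} {1}           (s≤s ()) _ _

          deleted⇒~ : ∀ {es u v} → Deleted G es u v → u ~ v
          deleted⇒~ (here {x = _ , _ , xy} (inj₁ (refl , refl))) = xy
          deleted⇒~ (here {x = _ , _ , xy} (inj₂ (refl , refl))) = ~-sym xy
          deleted⇒~ (there d) = deleted⇒~ d

          h-step : ∀ {i} → suc i < 3 + m → h i ~ h (suc i)
          h-step {0}           _ = deleted⇒~ deletedνμ
          h-step {1}           _ = subst (μ ~_) (sym P.first) (proj₁ μ~l)
          h-step {suc (suc i)} i< = proj₁ (P.step (below i<))

          h-close : h (2 + m) ~ h 0
          h-close = subst (_~ ν) (sym last-at) (~-sym (proj₁ ν~e))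

          h-steps : ∀ {i j} → i < j → j < 3 + m → h i ~ h j → suc i ≡ j ⊎ (suc j ≡ 3 + m × i ≡ 0)
          h-steps {0} {1} _ _ _ = inj₁ refl
          h-steps {0} {suc (suc j)} _ j< ν~v = inj₂ (cong (3 +_) j≡m , refl)
            where
            at≡e : P.at j ≡ e
            at≡e = nbr (ν-nbr (U-edge (P.inside (below j<)) ν~v))
            j≡m : j ≡ m
            j≡m with ℕ.<-cmp j m
            ... | tri< j<m _ _ = contradiction (trans at≡e (sym last-at)) (P.injective j<m (≤-reflexive (sym ∣U∣)))
            ... | tri≈ _ eq _  = eq
            ... | tri> _ _ m<j = contradiction (trans last-at (sym at≡e)) (P.injective m<j (below j<))
          h-steps {1} {1} (s≤s ()) _ _
          h-steps {1} {suc (suc zero)} _ _ _ = inj₁ refl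
          h-steps {1} {suc (suc (suc j))} _ j< μ~v = contradiction
            (trans P.first (sym (nbr (μ-nbr (U-edge (P.inside (below j<)) μ~v)))))
            (P.injective (s≤s z≤n) (below j<))
          h-steps {suc (suc i)} {1} (s≤s ()) _ _
          h-steps {suc (suc i)} {suc (suc j)} (s≤s (s≤s i<j)) j< v~w =
            inj₁ (cong (2 +_) (sym (P.steps i<j (below j<) (U-edge (P.inside (below j<)) v~w))))

          cyclic : IsCycle G
          cyclic = CycleGraph.isCycle {m = m} G h surjective injective h-step h-close h-steps

        result : (k ≡ 1 × IsCycle G) ⊎ Enlargement
        result with nonempty? Z
        ... | yes (z , z∈Z) = inj₂ (swapInZ z∈Z)
        ... | no empty      = inj₁ (trans (sym ∣Z∣) (cong suc (∣p∣≡0 empty)) , cyclic empty)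

      open Shaped public using (result)

    module Independent (independent : ∀ {u v} → u ∈ U → v ∈ U → ¬ u H.~ v) where

      N⊆W : ∀ {u v} → u ∈ U → v ∈ Separations.N k H u → v ∈ W
      N⊆W u∈U v∈N = ∈∁⁺ λ v∈U → independent u∈U v∈U (Separations.∈N⁻ k H v∈N)

      -- The at least `d` neighbours of an uncovered vertex lie in `W` and must fill it. So `W`
      -- itself serves as the set `Z` of `swapEdge`, and any matching edge will do.
      W-complete : ∀ {z w} → z ∈ W → w ∉ W → w H.~ z
      W-complete {z} {w} z∈W w∉W = Separations.∈N⁻ k H (trapped (N⊆W w∈U) (≤-trans ∣W∣≤d (degreeU≥d w∈U)) z∈W)
        where
        w∈U : w ∈ U
        w∈U = decidable-stable (w ∈? U) λ w∉U → w∉W (∈∁⁺ w∉U)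

      swapInW : ∀ {u v} → u ∈ U → v ∈ U → u ≢ v → Enlargement
      swapInW u∈U v∈U u≢v with 1≤∣p∣⁻ {p = W} (≤-trans (≤-trans (s≤s z≤n) k<d) (≤-trans (degreeU≥d u∈U) (mono (N⊆W u∈U))))
      ... | w , w∈W with extract (∈∁uncovered⁻ G w∈W)
      ...   | (x , y , xy) , es′ , _ , perm = swapEdge G k degree≥1+k good perm
                (∈∁uncovered⁺ G (Any-resp-↭ (↭-sym perm) (here (inj₁ refl))))
                (∈∁uncovered⁺ G (Any-resp-↭ (↭-sym perm) (here (inj₂ refl))))
                (λ u∈W → ∈∁⁻ u∈W u∈U) (λ v∈W → ∈∁⁻ v∈W v∈U) u≢v u∈U v∈U W-complete

    -- The chain `d + 1 ≤ n ≤ 1 + # W ≤ 1 + 2 * length es ≤ 1 + d` collapses to equalities.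
    completeCase : # U ≤ 1 → 2 ∣ d × G ≅ complete (d + 1)
    completeCase ∣U∣≤1 = divides (length es) d≡ , isComplete (d + 1) G n≡ adjacent
      where
      ∣U∣+∣W∣ : # U + # W ≡ n
      ∣U∣+∣W∣ = ∣p∣+∣∁p∣≡n

      others : ∀ {u v} → u ∈ ∁ (Separations.N k G v) → suc (# (Separations.N k G v)) ≤ n
      others {u} {v} u∉ = linear (# (Separations.N k G v) ∷ # (∁ (Separations.N k G v)) ∷ n ∷ [])
          (λ { (a ∷ b ∷ n ∷ []) →
              a ⊞ b ≼ n ∷ con 1 ≼ b ∷ []
              ⊢ con 1 ⊞ a ≼ n })
          (≤-reflexive (∣p∣+∣∁p∣≡n {p = Separations.N k G v})) (1≤∣p∣ u∉)

      self∉ : ∀ u → u ∈ ∁ (Separations.N k G u)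
      self∉ u = ∈∁⁺ λ u∈ → ~-irrefl refl (Separations.∈N⁻ k G u∈)

      d<n : suc d ≤ n
      d<n = ≤-trans (s≤s (degree≥d (fromℕ< k<n))) (others (self∉ (fromℕ< k<n)))

      d≤ : d ≤ length es + length es
      d≤ = linear (d ∷ n ∷ # U ∷ # W ∷ length es ∷ [])
          (λ { (d ∷ n ∷ a ∷ b ∷ c ∷ []) →
              con 1 ⊞ d ≼ n ∷ n ≼ a ⊞ b ∷ a ≼ con 1 ∷ b ≼ c ⊞ c ∷ []
              ⊢ d ≼ c ⊞ c })
          d<n (≤-reflexive (sym ∣U∣+∣W∣)) ∣U∣≤1 ∣W∣≤2∣es∣

      d≡ : d ≡ length es * 2
      d≡ = trans (ℕ.≤-antisym d≤ 2∣es∣≤d)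
        (trans (cong (length es +_) (sym (ℕ.+-identityʳ _))) (ℕ.*-comm 2 (length es)))

      n≤ : n ≤ d + 1
      n≤ = linear (n ∷ # U ∷ # W ∷ d ∷ [])
          (λ { (n ∷ a ∷ b ∷ d ∷ []) →
              n ≼ a ⊞ b ∷ a ≼ con 1 ∷ b ≼ d ∷ []
              ⊢ n ≼ d ⊞ con 1 })
          (≤-reflexive (sym ∣U∣+∣W∣)) ∣U∣≤1 ∣W∣≤d

      d+1≤ : d + 1 ≤ n
      d+1≤ = linear (d ∷ n ∷ [])
          (λ { (d ∷ n ∷ []) →
              con 1 ⊞ d ≼ n ∷ []
              ⊢ d ⊞ con 1 ≼ n })
          d<n

      n≡ : n ≡ d + 1
      n≡ = ℕ.≤-antisym n≤ d+1≤

      adjacent : ∀ u v → u ≢ v → u ~ v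
      adjacent u v u≢v with u ~? v
      ... | yes u~v = u~v
      ... | no u≁v  = absurd (linear (# (Separations.N k G u) ∷ # (∁ (Separations.N k G u)) ∷ n ∷ d ∷ [])
          (λ { (a ∷ b ∷ n ∷ d ∷ []) →
              con 2 ≼ b ∷ a ⊞ b ≼ n ∷ n ≼ d ⊞ con 1 ∷ d ≼ a ∷ []
              ⊢ con 1 ≼ con 0 })
          (2≤∣p∣ (self∉ u) v∉ u≢v) (≤-reflexive (∣p∣+∣∁p∣≡n {p = Separations.N k G u}))
          n≤ (degree≥d u))
        where
        v∉ : v ∈ ∁ (Separations.N k G u)
        v∉ = ∈∁⁺ (u≁v ∘ Separations.∈N⁻ k G)

  enlarge : ¬ ((k ≡ 1 × IsCycle G) ⊎ (2 ∣ d × G ≅ complete (d + 1))) →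
            ∃ λ fs → length fs ≡ suc (length es) × Good G k fs
  enlarge ¬exception with Fin.any? (λ u → (u ∈? U) ×-dec Fin.any? (λ v → (v ∈? U) ×-dec ((u H.~? v) ×-dec ¬? (critical? k H u v))))
  ... | yes (u , u∈U , v , v∈U , u~v , ¬c) = (u , v , proj₁ u~v) ∷ es , refl , augment G k good u∈U v∈U u~v ¬c
  ... | no none with Fin.any? (λ u → (u ∈? U) ×-dec Fin.any? (λ v → (v ∈? U) ×-dec (u H.~? v)))
  ...   | yes (u , u∈U , v , v∈U , u~v) =
    [ (λ cyclic → contradiction (inj₁ cyclic) ¬exception) , (λ fs → fs) ]′ (AC.result (AC.shape u∈U v∈U u~v))
    where
    critical : ∀ {u v} → u ∈ U → v ∈ U → u H.~ v → ∃₂ (Separations.Critical k H u v)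
    critical {u} {v} u∈U v∈U u~v = decidable-stable (critical? k H u v) λ ¬c →
      none (u , u∈U , v , v∈U , u~v , ¬c)
    module AC = AllCritical critical
  ...   | no noEdge with # U ℕ.≤? 1
  ...     | yes small = contradiction (inj₂ (completeCase small)) ¬exception
  ...     | no big with 1≤∣p∣⁻ {p = U} (≤-trans (s≤s z≤n) (ℕ.≰⇒> big))
  ...       | u , u∈U with another (ℕ.≰⇒> big) u
  ...         | v , v∈U , v≢u = Independent.swapInW (λ {u} {v} u∈U v∈U u~v → noEdge (u , u∈U , v , v∈U , u~v))
                                  u∈U v∈U (v≢u ∘ sym)

-- Growing the matching from the empty one

δ≤degree : ∀ {n} (G : Graph (Fin n)) u → δ G ≤ degree G u
δ≤degree {suc n} G u = fold (degree G) u
  where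
  fold : ∀ {n} (f : Fin (suc n) → ℕ) i → foldr₁ _⊓_ (tabulate f) ≤ f i
  fold {zero}  f zero    = ≤-refl
  fold {suc n} f zero    = ℕ.m⊓n≤m _ _
  fold {suc n} f (suc i) = ≤-trans (ℕ.m⊓n≤n _ _) (fold (f ∘ suc) i)

<⌈n/2⌉ : ∀ j n → suc j ≤ ⌈ n /2⌉ → suc (j + j) ≤ n
<⌈n/2⌉ zero    (suc n)       _       = s≤s z≤n
<⌈n/2⌉ (suc j) (suc (suc n)) (s≤s h) = linear (j ∷ n ∷ [])
    (λ { (j ∷ n ∷ []) →
        con 1 ⊞ j ⊞ j ≼ n ∷ []
        ⊢ con 2 ⊞ j ⊞ (con 1 ⊞ j) ≼ con 2 ⊞ n })
    (<⌈n/2⌉ j n h)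

corollary1p4 : (k : ℕ) → 1 ≤ k → (n : ℕ) (G : Graph (Fin n)) → KConnected k G → k + 1 ≤ δ G →
    ¬ ((k ≡ 1 × IsCycle G) ⊎ (2 ∣ δ G × G ≅ complete (δ G + 1))) →
    ∃ λ (M : Matching G) → Matching.size M ≡ ⌈ δ G + 1 /2⌉ × Removable k G M
corollary1p4 k _ n G connected k<δ ¬exception = matching
  where
  k<n = proj₁ connected

  degree≥δ : ∀ v → δ G ≤ # (Separations.N k G v)
  degree≥δ v = subst (δ G ≤_) (sym (Separations.∣N∣≡degree k G)) (δ≤degree G v)

  k<δ′ : suc k ≤ δ G
  k<δ′ = subst (_≤ δ G) (ℕ.+-comm k 1) k<δ

  build : ∀ j → j ≤ ⌈ δ G + 1 /2⌉ → ∃ λ es → length es ≡ j × Good G k es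
  build zero    _ = [] , refl , [] , λ A≢∅ B≢∅ disj noEdge →
    cutBound k G connected A≢∅ B≢∅ disj λ a∈ b∈ a~b → noEdge a∈ b∈ (a~b , λ ())
  build (suc j) h with build j (≤-trans (ℕ.n≤1+n j) h)
  ... | es , refl , good = Enlarge.enlarge G k (δ G) k<n k<δ′ degree≥δ good
    -- The target size is the least `j` with `j + j > δ G`, so the condition of `Enlarge` holds
    -- until it is reached.
    (ℕ.≤-pred (subst (suc (length es + length es) ≤_) (ℕ.+-comm (δ G) 1) (<⌈n/2⌉ (length es) (δ G + 1) h))) ¬exception

  matching : ∃ λ (M : Matching G) → Matching.size M ≡ ⌈ δ G + 1 /2⌉ × Removable k G M
  matching with build ⌈ δ G + 1 /2⌉ ≤-refl
  ... | es , size , disjoint , kc =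
    record { edges = es ; disjoint = disjoint } , size , kConnected k (deleteEdges G es) k<n kc
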